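{- Let $G=(V,E)$ be an undirected graph with $n=|V|\ge 1$ vertices, let $k$ be a positive integer, let $\lambda(k)=\frac{k-1}{k}$, and let $\tau,\rho$ be rational numbers with $0<\tau<\rho<1$ such that either $$\rho \in \left(1 - \frac{4}{(n+1)^2},\; 1 - \frac{1}{(n+1)^2}\right] \quad\text{and}\quad \tau \in \left[(1 - \rho)(n-1),\; \rho - (1 - \sqrt{1-\rho})^2\right),$$ or $$\rho \in \left(1 - \frac{1}{(n+1)^2},\; 1 \right) \quad\text{and}\quad \tau \in \left[(1 - \rho)(n-1),\; (1 - \rho)(n-1) + \frac{1}{n+1}\right).$$ Then the game $\Gamma_{k,\tau,\rho}(G)$ has an evolutionarily stable strategy if and only if $G$ has no clique of size $k$.
   Context: Games and ESS. A finite symmetric two-player game is given by a finite set $S$ of pure strategies and a payoff function $u_1:S\times S\to\mathbb{R}$ of the row player (the column player's payoff is $u_2(i,j)=u_1(j,i)$). A mixed strategy is a probability vector $s$ on $S$, and $U_1(s,t)=\sum_{i,j\in S}s(i)t(j)u_1(i,j)$. A mixed strategy $t$ is a best response to $s$ if $U_1(t,s)=\max_{t'}U_1(t',s)$ over all mixed strategies $t'$. A mixed strategy $s$ is an evolutionarily stable strategy (ESS) if (1) $U_1(s,s)\ge U_1(t,s)$ for every mixed strategy $t$, and (2) for every best response $t\ne s$ to $s$, $U_1(s,t)>U_1(t,t)$. The game. Graphs are finite, undirected and without loops. A clique of $G$ is a set of pairwise adjacent vertices, and its size is its number of vertices. The symmetric game $\Gamma_{k,\tau,\rho}(G)$ has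 pure strategy set $S=V\cup\{a,b,c\}$, where $a,b,c$ are three distinct elements not in $V$, and payoffs: - $u_1(i,j)=\rho$ for $i,j\in V$ with $(i,j)\in E$; - $u_1(i,j)=\tau$ for $i,j\in V$ with $(i,j)\notin E$ (including $i=j$); - $u_1(z,a)=\rho$ for all $z\in S\setminus\{b,c\}$; - $u_1(a,i)=\lambda(k)=\frac{k-1}{k}$ for all $i\in V$; - $u_1(y,i)=\rho$ for $y\in\{b,c\}$, $i\in V$; - $u_1(y,a)=\tau$ for $y\in\{b,c\}$; - $u_1(z,y)=\tau$ for all $z\in S$, $y\in\{b,c\}$. -}

module Defs where

open import Algebra.Apartness.Bundles using (HeytingField; module HeytingCommutativeRing)
open import Algebra.Bundles using (CommutativeRing)
import Algebra.Properties.CommutativeMonoid.Sum as Sum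
open import Algebra.Morphism.Structures using (module RingMorphisms)
open import Data.Fin.Base using (Fin; zero; suc)
open import Data.Fin.Properties using (+↔⊎)
open import Data.Fin.Subset using (Subset; _∈_; ∣_∣)
open import Data.Integer.Base using (+_)
open import Data.Nat.Base as ℕ using (ℕ; NonZero; _∸_; _^_)
open import Data.Product.Base using (∃-syntax; _×_)
open import Data.Rational.Base as ℚ using (ℚ; 0ℚ; 1ℚ; _/_)
open import Data.Sum.Base using (_⊎_; inj₁; inj₂)
open import Function.Base using (_∘_)
open import Function.Bundles using (_⇔_; _↔_; Inverse)
open import Level using (Level; 0ℓ; _⊔_) renaming (suc to lsuc)
open import Relation.Binary.Core using (Rel)
open import Relation.Binary.Definitions using (Cotransitive; Decidable; Irreflexive; Symmetric)
open import Relation.Binary.PropositionalEquality.Core using (_≡_; _≢_)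
open import Relation.Binary.Structures using (IsStrictPartialOrder)
open import Relation.Nullary.Decidable.Core using (does)
open import Relation.Nullary.Negation.Core using (¬_)
open import Data.Bool.Base using (if_then_else_)

-- The real numbers, axiomatised up to isomorphism as a Cauchy-complete
-- Archimedean ordered field.  The order axioms are the constructive ones: they
-- hold for the Bishop reals and, classically, for any model of ℝ.
record Reals c ℓ₁ ℓ₂ : Set (lsuc (c ⊔ ℓ₁ ⊔ ℓ₂)) where
  field
    heytingField : HeytingField c ℓ₁ ℓ₂

  open HeytingField heytingField public

  infix 4 _<_ _≤_

  field
    _<_                  : Rel Carrier ℓ₂
    isStrictPartialOrder : IsStrictPartialOrder _≈_ _<_
    <-cotrans            : Cotransitive _<_
    #⇔<⊎>                : ∀ {x y} → x # y ⇔ (x < y ⊎ y < x)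
    +-monoˡ-<            : ∀ {x y} z → x < y → x + z < y + z
    *-pos                : ∀ {x y} → 0# < x → 0# < y → 0# < x * y

  _≤_ : Rel Carrier ℓ₂
  x ≤ y = ¬ (y < x)

  open CommutativeRing (HeytingCommutativeRing.commutativeRing heytingCommutativeRing) public
    using (rawRing; +-commutativeMonoid)

  field
    -- The inclusion of ℚ is determined uniquely by these laws; density of its
    -- image is the Archimedean property.
    ι                    : ℚ → Carrier
    ι-isRingHomomorphism :
      RingMorphisms.IsRingHomomorphism ℚ.+-*-rawRing rawRing ι
    ι-mono-<             : ∀ {p q} → p ℚ.< q → ι p < ι q
    ι-dense              : ∀ {x y} → x < y → ∃[ q ] x < ι q × ι q < y

  IsCauchy : (ℕ → Carrier) → Set ℓ₂
  IsCauchy x = ∀ ε → 0ℚ ℚ.< ε →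
    ∃[ N ] ∀ m n → N ℕ.≤ m → N ℕ.≤ n → x m - x n < ι ε

  _ConvergesTo_ : (ℕ → Carrier) → Carrier → Set ℓ₂
  x ConvergesTo l = ∀ ε → 0ℚ ℚ.< ε →
    ∃[ N ] ∀ n → N ℕ.≤ n → x n - l < ι ε × l - x n < ι ε

  field
    complete : ∀ x → IsCauchy x → ∃[ l ] x ConvergesTo l

  _IsSqrtOf_ : Carrier → Carrier → Set (ℓ₁ ⊔ ℓ₂)
  σ IsSqrtOf x = 0# ≤ σ × σ * σ ≈ x

record Graph (n : ℕ) : Set₁ where
  field
    Adj    : Rel (Fin n) 0ℓ
    adj?   : Decidable Adj
    sym    : Symmetric Adj
    irrefl : Irreflexive _≡_ Adj

module _ {n : ℕ} (G : Graph n) where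
  open Graph G

  IsClique : Subset n → Set
  IsClique C = ∀ {i j} → i ∈ C → j ∈ C → i ≢ j → Adj i j

  HasCliqueOfSize : ℕ → Set
  HasCliqueOfSize k = ∃[ C ] IsClique C × ∣ C ∣ ≡ k

module _ {c ℓ₁ ℓ₂ : Level} (R : Reals c ℓ₁ ℓ₂) where
  open Reals R

  -- u₁ is the row player's payoff; the column player's is u₁ with its
  -- arguments swapped.
  record SymmetricGame : Set (lsuc 0ℓ ⊔ c) where
    field
      S    : Set
      size : ℕ
      enum : Fin size ↔ S
      u₁   : S → S → Carrier

  module _ (Γ : SymmetricGame) where
    open SymmetricGame Γ

    ∑ : (S → Carrier) → Carrier
    ∑ f = Sum.sum +-commutativeMonoid (f ∘ Inverse.to enum)

    record MixedStrategy : Set (c ⊔ ℓ₁ ⊔ ℓ₂) where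
      field
        prob   : S → Carrier
        nonNeg : ∀ i → 0# ≤ prob i
        total  : ∑ prob ≈ 1#

    open MixedStrategy

    U₁ : MixedStrategy → MixedStrategy → Carrier
    U₁ s t = ∑ λ i → ∑ λ j → prob s i * prob t j * u₁ i j

    -- Distinctness of strategies, in the positive form proper to constructive
    -- reals; classically this is just inequality of the probability vectors.
    Distinct : MixedStrategy → MixedStrategy → Set ℓ₂
    Distinct s t = ∃[ i ] prob s i # prob t i

    IsBestResponse : MixedStrategy → MixedStrategy → Set (c ⊔ ℓ₁ ⊔ ℓ₂)
    IsBestResponse t s = ∀ t′ → U₁ t′ s ≤ U₁ t s

    IsESS : MixedStrategy → Set (c ⊔ ℓ₁ ⊔ ℓ₂)
    IsESS s = (∀ t → U₁ t s ≤ U₁ s s)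
            × (∀ t → IsBestResponse t s → Distinct t s → U₁ t t < U₁ s t)

    HasESS : Set (c ⊔ ℓ₁ ⊔ ℓ₂)
    HasESS = ∃[ s ] IsESS s

Strategy : ℕ → Set
Strategy n = Fin n ⊎ Fin 3

pattern vertex i = inj₁ i
pattern a = inj₂ zero
pattern b = inj₂ (suc zero)
pattern c = inj₂ (suc (suc zero))

-- (k - 1) / k; the truncated subtraction is exact since k ≥ 1.
lam : (k : ℕ) .{{_ : NonZero k}} → ℚ
lam k = + (k ∸ 1) / k

payoff : ∀ {n} (k : ℕ) .{{_ : NonZero k}} (τ ρ : ℚ) → Graph n →
         Strategy n → Strategy n → ℚ
payoff k τ ρ G (vertex i) (vertex j) = if does (Graph.adj? G i j) then ρ else τ
payoff k τ ρ G a          (vertex _) = lam k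
payoff k τ ρ G b          (vertex _) = ρ
payoff k τ ρ G c          (vertex _) = ρ
payoff k τ ρ G (vertex _) a          = ρ
payoff k τ ρ G a          a          = ρ
payoff k τ ρ G b          a          = τ
payoff k τ ρ G c          a          = τ
payoff k τ ρ G _          b          = τ
payoff k τ ρ G _          c          = τ

cliqueGame : ∀ {ℓ ℓ₁ ℓ₂} (R : Reals ℓ ℓ₁ ℓ₂) {n} (k : ℕ) .{{_ : NonZero k}}
             (τ ρ : ℚ) → Graph n → SymmetricGame R
cliqueGame R {n} k τ ρ G = record
  { S    = Strategy n
  ; size = n ℕ.+ 3
  ; enum = +↔⊎
  ; u₁   = λ i j → Reals.ι R (payoff k τ ρ G i j)
  }

InFirstRange : ∀ {ℓ ℓ₁ ℓ₂} → Reals ℓ ℓ₁ ℓ₂ → ℕ → (τ ρ : ℚ) → Set (ℓ ⊔ ℓ₁ ⊔ ℓ₂)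
InFirstRange R n τ ρ =
    1ℚ ℚ.- + 4 / (ℕ.suc n ^ 2) ℚ.< ρ
  × ρ ℚ.≤ 1ℚ ℚ.- + 1 / (ℕ.suc n ^ 2)
  × (1ℚ ℚ.- ρ) ℚ.* (+ (n ∸ 1) / 1) ℚ.≤ τ
  × ∃[ σ ] σ IsSqrtOf ι (1ℚ ℚ.- ρ) × ι τ < ι ρ - (1# - σ) * (1# - σ)
  where open Reals R

InSecondRange : ℕ → (τ ρ : ℚ) → Set
InSecondRange n τ ρ =
    1ℚ ℚ.- + 1 / (ℕ.suc n ^ 2) ℚ.< ρ
  × ρ ℚ.< 1ℚ
  × (1ℚ ℚ.- ρ) ℚ.* (+ (n ∸ 1) / 1) ℚ.≤ τ
  × τ ℚ.< (1ℚ ℚ.- ρ) ℚ.* (+ (n ∸ 1) / 1) ℚ.+ + 1 / ℕ.suc n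

{-# OPTIONS --safe #-}
-- The pure strategy a is a symmetric equilibrium.  A best response t to a has no weight on
-- b and c, and if t puts weights x on V with sum X, then U(a,t) - U(t,t) = λX² - xᵀAx.  By
-- Motzkin–Straus the maximum of xᵀAx / X² is ρ - (ρ-τ)/ω, with ω the clique number, and
-- the conditions on τ and ρ ensure that it is < λ(k) when ω < k and ≥ λ(k) when ω ≥ k.
-- No other s is an ESS: b and c are interchangeable, so they get no weight; a strategy
-- supported on V is beaten by b, as xᵀAx < ρX²; and if a is in the support of s ≠ a, then a
-- is a best response to s with U(s,a) = ρ = U(a,a).
--
-- All inequalities ≤ are negations, so classical case distinctions are available when
-- proving them, and only the strict ones need care.
module Submission where

open import Defs
open import Algebra.Apartness.Bundles using (module HeytingCommutativeRing)
open import Algebra.Bundles using (CommutativeRing)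
open import Algebra.Morphism.Structures using (module RingMorphisms)
import Algebra.Properties.Group as GroupProperties
import Algebra.Properties.Semiring.Sum as SemiringSum
import Algebra.Solver.Ring as RingSolver
open import Algebra.Solver.Ring.AlmostCommutativeRing using
  (fromCommutativeRing; _-Raw-AlmostCommutative⟶_)
open import Data.Bool.Base using (if_then_else_; true; false)
import Data.Empty as Empty
open import Data.Fin.Base using (Fin; zero; suc; splitAt)
open import Data.Fin.Properties using (_≟_; any?)
open import Data.Fin.Subset as Subset using (Subset; _∈_; _⊆_; ∣_∣; ⁅_⁆; ⊤)
open import Data.Fin.Subset.Properties using
  (_∈?_; ∈⊤; ∉⊥; ∣⊥∣≡0; ∣p∣≤n; ∣⁅x⁆∣≡1; x∈⁅y⁆⇒x≡y; x∈p⇒∣p-x∣<∣p∣; x∈p∧x≢y⇒x∈p-y)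
open import Data.Integer.Base as ℤ using (ℤ; +_; -[1+_])
import Data.Integer.Properties as ℤ
open import Data.Maybe.Base using (Maybe; just; nothing)
open import Data.Nat.Base as ℕ using (ℕ; NonZero; zero; suc)
open import Data.Nat.Induction using (<-wellFounded)
import Data.Nat.Properties as ℕ
open import Data.Product.Base using (∃-syntax; _×_; _,_; proj₁; proj₂)
open import Data.Rational.Base as ℚ using (ℚ; 0ℚ; 1ℚ; _/_)
import Data.Rational.Properties as ℚ
open import Data.Rational.Unnormalised.Base as ℚᵘ using (mkℚᵘ; *≡*)
import Data.Rational.Unnormalised.Properties as ℚᵘ
open import Data.Sum.Base as Sum using (_⊎_; inj₁; inj₂; [_,_]′)
open import Data.Vec.Base using ([]; _∷_; here; there)
open import Function.Base using (_∘_; _$_; case_of_)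
open import Function.Bundles using (_⇔_; mk⇔; Equivalence)
open import Induction.WellFounded using (Acc; acc)
open import Relation.Binary.Definitions using (tri<; tri≈; tri>)
open import Relation.Binary.PropositionalEquality as ≡ using (_≡_; _≢_)
open import Relation.Binary.Structures using (module IsStrictPartialOrder)
open import Relation.Nullary.Decidable using
  (Dec; yes; no; does; dec-true; dec-false; decidable-stable; ¬?; _×-dec_)
open import Relation.Nullary.Negation.Core using (¬_; contradiction)

-- Fractions in ℚ.

private
  module ℚ-group = GroupProperties ℚ.+-0-group

-- A fraction `z / d` is `fromℚᵘ` of an unnormalised one. Given compatibility with products and
-- sums, identities between fractions reduce to integer identities by cross-multiplication.
fromℚᵘ-homo-* : ∀ p q → ℚ.fromℚᵘ (p ℚᵘ.* q) ≡ ℚ.fromℚᵘ p ℚ.* ℚ.fromℚᵘ q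
fromℚᵘ-homo-* p q = ℚ.toℚᵘ-injective $ begin
  ℚ.toℚᵘ (ℚ.fromℚᵘ (p ℚᵘ.* q))                     ≈⟨ ℚ.toℚᵘ-fromℚᵘ (p ℚᵘ.* q) ⟩
  p ℚᵘ.* q                                         ≈⟨ ℚᵘ.*-cong (ℚ.toℚᵘ-fromℚᵘ p) (ℚ.toℚᵘ-fromℚᵘ q) ⟨
  ℚ.toℚᵘ (ℚ.fromℚᵘ p) ℚᵘ.* ℚ.toℚᵘ (ℚ.fromℚᵘ q)     ≈⟨ ℚ.toℚᵘ-homo-* (ℚ.fromℚᵘ p) (ℚ.fromℚᵘ q) ⟨
  ℚ.toℚᵘ (ℚ.fromℚᵘ p ℚ.* ℚ.fromℚᵘ q)               ∎
  where open ℚᵘ.≃-Reasoning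

fromℚᵘ-homo-+ : ∀ p q → ℚ.fromℚᵘ (p ℚᵘ.+ q) ≡ ℚ.fromℚᵘ p ℚ.+ ℚ.fromℚᵘ q
fromℚᵘ-homo-+ p q = ℚ.toℚᵘ-injective $ begin
  ℚ.toℚᵘ (ℚ.fromℚᵘ (p ℚᵘ.+ q))                     ≈⟨ ℚ.toℚᵘ-fromℚᵘ (p ℚᵘ.+ q) ⟩
  p ℚᵘ.+ q                                         ≈⟨ ℚᵘ.+-cong (ℚ.toℚᵘ-fromℚᵘ p) (ℚ.toℚᵘ-fromℚᵘ q) ⟨
  ℚ.toℚᵘ (ℚ.fromℚᵘ p) ℚᵘ.+ ℚ.toℚᵘ (ℚ.fromℚᵘ q)     ≈⟨ ℚ.toℚᵘ-homo-+ (ℚ.fromℚᵘ p) (ℚ.fromℚᵘ q) ⟨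
  ℚ.toℚᵘ (ℚ.fromℚᵘ p ℚ.+ ℚ.fromℚᵘ q)               ∎
  where open ℚᵘ.≃-Reasoning

+-/1 : ∀ y z → (y ℤ.+ z) / 1 ≡ (y / 1) ℚ.+ (z / 1)
+-/1 y z = ≡.trans
  (ℚ.fromℚᵘ-cong {mkℚᵘ (y ℤ.+ z) 0} {mkℚᵘ y 0 ℚᵘ.+ mkℚᵘ z 0}
    (*≡* (≡.cong (ℤ._* + 1) (≡.sym (≡.cong₂ ℤ._+_ (ℤ.*-identityʳ y) (ℤ.*-identityʳ z))))))
  (fromℚᵘ-homo-+ (mkℚᵘ y 0) (mkℚᵘ z 0))

*-/1 : ∀ y z → (y ℤ.* z) / 1 ≡ (y / 1) ℚ.* (z / 1)
*-/1 y z = fromℚᵘ-homo-* (mkℚᵘ y 0) (mkℚᵘ z 0)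

/-*-cancel : ∀ z d .{{_ : NonZero d}} → (z / d) ℚ.* (+ d / 1) ≡ z / 1
/-*-cancel z d@(suc d-1) = ≡.trans
  (≡.sym (fromℚᵘ-homo-* (mkℚᵘ z d-1) (mkℚᵘ (+ d) 0)))
  (ℚ.fromℚᵘ-cong {mkℚᵘ z d-1 ℚᵘ.* mkℚᵘ (+ d) 0} {mkℚᵘ z 0}
    (*≡* (≡.trans (ℤ.*-identityʳ (z ℤ.* + d)) (≡.cong ((z ℤ.*_) ∘ +_) (≡.sym (ℕ.*-identityʳ d))))))
  
/-nonNeg : ∀ m d .{{_ : NonZero d}} → 0ℚ ℚ.≤ + m / d
/-nonNeg m d = ℚ.nonNegative⁻¹ (+ m / d) {{ℚ.normalize-nonNeg m d}}

-- Arithmetic and order of the reals, with a ring solver over integer coefficients.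

module RealArithmetic {ℓ ℓ₁ ℓ₂} (R : Reals ℓ ℓ₁ ℓ₂) where
  open Reals R
  open IsStrictPartialOrder isStrictPartialOrder public
    using () renaming (irrefl to <-irrefl; trans to <-trans; <-respʳ-≈ to <-respʳ; <-respˡ-≈ to <-respˡ)

  ring : CommutativeRing ℓ ℓ₁
  ring = HeytingCommutativeRing.commutativeRing heytingCommutativeRing

  module ι = RingMorphisms.IsRingHomomorphism ι-isRingHomomorphism

  -- The separate clause for 1 makes `nat 1` reduce to `1#`, so that the solver constant `:1`
  -- denotes `1#` and not `1# + 0#`.
  nat : ℕ → Carrier
  nat zero          = 0#
  nat (suc zero)    = 1#
  nat (suc (suc n)) = 1# + nat (suc n)

  nat-suc : ∀ n → nat (suc n) ≈ 1# + nat n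
  nat-suc zero    = sym (+-identityʳ 1#)
  nat-suc (suc n) = refl

  nat-ι : ∀ n → nat n ≈ ι (+ n / 1)
  nat-ι zero    = sym ι.0#-homo
  nat-ι (suc n) = trans (nat-suc n) (trans (+-cong (sym ι.1#-homo) (nat-ι n))
    (trans (sym (ι.+-homo 1ℚ (+ n / 1))) (reflexive (≡.cong ι (≡.sym (+-/1 (+ 1) (+ n)))))))

  fromℤ : ℤ → Carrier
  fromℤ (+ n)    = nat n
  fromℤ -[1+ n ] = - nat (suc n)

  -- Through this the homomorphism laws of `fromℤ`, required by the solver, are pulled back from
  -- those of `ι`.
  fromℤ-ι : ∀ z → fromℤ z ≈ ι (z / 1)
  fromℤ-ι (+ n)    = nat-ι n
  fromℤ-ι -[1+ n ] = trans (-‿cong (nat-ι (suc n))) (sym (ι.-‿homo (+ suc n / 1)))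

  private
    neg-/1 : ∀ z → (ℤ.- z) / 1 ≡ ℚ.- (z / 1)
    neg-/1 (+ 0)       = ≡.refl
    neg-/1 (+ suc n)   = ≡.refl
    neg-/1 -[1+ n ]    = ≡.sym (ℚ-group.⁻¹-involutive (+ suc n / 1))

    dec : ∀ {y z} → Dec (y ≡ z) → Maybe (fromℤ y ≈ fromℤ z)
    dec (yes y≡z) = just (reflexive (≡.cong fromℤ y≡z))
    dec (no _)    = nothing

    fromℤ-homomorphism : ℤ.+-*-rawRing -Raw-AlmostCommutative⟶ fromCommutativeRing ring
    fromℤ-homomorphism = record
      { ⟦_⟧    = fromℤ
      ; +-homo = λ y z → trans (fromℤ-ι (y ℤ.+ z)) (trans (reflexive (≡.cong ι (+-/1 y z)))
                   (trans (ι.+-homo (y / 1) (z / 1)) (sym (+-cong (fromℤ-ι y) (fromℤ-ι z)))))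
      ; *-homo = λ y z → trans (fromℤ-ι (y ℤ.* z)) (trans (reflexive (≡.cong ι (*-/1 y z)))
                   (trans (ι.*-homo (y / 1) (z / 1)) (sym (*-cong (fromℤ-ι y) (fromℤ-ι z)))))
      ; -‿homo = λ z → trans (fromℤ-ι (ℤ.- z)) (trans (reflexive (≡.cong ι (neg-/1 z)))
                   (trans (ι.-‿homo (z / 1)) (-‿cong (sym (fromℤ-ι z)))))
      ; 0-homo = refl
      ; 1-homo = refl
      }

    coefficient-≟ : ∀ y z → Maybe (fromℤ y ≈ fromℤ z)
    coefficient-≟ y z = dec (y ℤ.≟ z)

  module Solver = RingSolver ℤ.+-*-rawRing (fromCommutativeRing ring) fromℤ-homomorphism coefficient-≟
  open Solver public using (solve; _:+_; _:*_; _:-_; :-_; _:=_; con; Polynomial)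

  :1 : ∀ {n} → Polynomial n
  :1 = con (+ 1)

  :0 : ∀ {n} → Polynomial n
  :0 = con (+ 0)

  ≈⇒≤ : ∀ {x y} → x ≈ y → x ≤ y
  ≈⇒≤ x≈y = <-irrefl (sym x≈y)

  <⇒≤ : ∀ {x y} → x < y → x ≤ y
  <⇒≤ x<y y<x = <-irrefl refl (<-trans x<y y<x)

  <-≤-trans : ∀ {x y z} → x < y → y ≤ z → x < z
  <-≤-trans {z = z} x<y y≤z = [ (λ x<z → x<z) , (λ z<y → contradiction z<y y≤z) ]′ (<-cotrans x<y z)

  ≤-trans : ∀ {x y z} → x ≤ y → y ≤ z → x ≤ z
  ≤-trans x≤y y≤z z<x = y≤z (<-≤-trans z<x x≤y)

  ≤-antisym : ∀ {x y} → x ≤ y → y ≤ x → x ≈ y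
  ≤-antisym {x} {y} x≤y y≤x = proj₁ (tight x y) ([ y≤x , x≤y ]′ ∘ Equivalence.to #⇔<⊎>)

  -- Doubly negated, since two reals cannot be compared decidably. This suffices for proving a `≤`:
  -- once its strict hypothesis is introduced, only the empty type is left as a goal.
  ≤-total : ∀ x y → ¬ ¬ (x ≤ y ⊎ y ≤ x)
  ≤-total x y ¬tot = ¬tot (inj₁ λ y<x → ¬tot (inj₂ (<⇒≤ y<x)))

  0≤y-x⇒x≤y : ∀ {x y} → 0# ≤ y - x → x ≤ y
  0≤y-x⇒x≤y {x} {y} 0≤ y<x = 0≤ (<-respʳ (-‿inverseʳ x) (+-monoˡ-< (- x) y<x))

  x≤y⇒0≤y-x : ∀ {x y} → x ≤ y → 0# ≤ y - x
  x≤y⇒0≤y-x {x} {y} x≤y <0 = x≤y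
    (<-respˡ (solve 2 (λ x y → y :- x :+ x := y) refl x y) (<-respʳ (+-identityˡ x) (+-monoˡ-< x <0)))

  0<y-x⇒x<y : ∀ {x y} → 0# < y - x → x < y
  0<y-x⇒x<y {x} {y} 0< =
    <-respˡ (+-identityˡ x) (<-respʳ (solve 2 (λ x y → y :- x :+ x := y) refl x y) (+-monoˡ-< x 0<))

  x<y⇒0<y-x : ∀ {x y} → x < y → 0# < y - x
  x<y⇒0<y-x {x} x<y = <-respˡ (-‿inverseʳ x) (+-monoˡ-< (- x) x<y)

  0≤-resp : ∀ {x y} → x ≈ y → 0# ≤ x → 0# ≤ y
  0≤-resp x≈y 0≤x y<0 = 0≤x (<-respˡ (sym x≈y) y<0)

  -- The usual shape of the estimates below: a visibly nonnegative `d` together with a ring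
  -- identity, left to the solver.
  ≤-by : ∀ {x y} d → 0# ≤ d → y - x ≈ d → x ≤ y
  ≤-by d 0≤d eq = 0≤y-x⇒x≤y (0≤-resp (sym eq) 0≤d)

  <-by : ∀ {x y} d → 0# < d → y - x ≈ d → x < y
  <-by d 0<d eq = 0<y-x⇒x<y (<-respʳ (sym eq) 0<d)

  +-nonNeg : ∀ {x y} → 0# ≤ x → 0# ≤ y → 0# ≤ x + y
  +-nonNeg {x} {y} 0≤x 0≤y = ≤-trans 0≤x
    (0≤y-x⇒x≤y (0≤-resp (solve 2 (λ x y → y := (x :+ y) :- x) refl x y) 0≤y))

  +-pos-nonNeg : ∀ {x y} → 0# < x → 0# ≤ y → 0# < x + y
  +-pos-nonNeg {x} {y} 0<x 0≤y = <-≤-trans 0<x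
    (0≤y-x⇒x≤y (0≤-resp (solve 2 (λ x y → y := (x :+ y) :- x) refl x y) 0≤y))

  -- If `x * y < 0#`, neither factor is zero, hence neither is `≤ 0#`. As `x ≤ 0#` is the negation
  -- of `0# < x`, both factors may be assumed positive, which makes the product positive.
  *-nonNeg : ∀ {x y} → 0# ≤ x → 0# ≤ y → 0# ≤ x * y
  *-nonNeg {x} {y} 0≤x 0≤y xy<0 = x≰0 λ 0<x → y≰0 λ 0<y → <⇒≤ (*-pos 0<x 0<y) xy<0
    where
    x≰0 : ¬ x ≤ 0#
    x≰0 x≤0 = <-irrefl (trans (*-congʳ (≤-antisym x≤0 0≤x)) (zeroˡ y)) xy<0
    y≰0 : ¬ y ≤ 0#
    y≰0 y≤0 = <-irrefl (trans (*-congˡ (≤-antisym y≤0 0≤y)) (zeroʳ x)) xy<0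

  sq-nonNeg : ∀ x → 0# ≤ x * x
  sq-nonNeg x xx<0 = ≤-total 0# x λ where
    (inj₁ 0≤x) → *-nonNeg 0≤x 0≤x xx<0
    (inj₂ x≤0) → 0≤-resp (solve 1 (λ x → (:0 :- x) :* (:0 :- x) := x :* x) refl x)
                   (*-nonNeg (x≤y⇒0≤y-x x≤0) (x≤y⇒0≤y-x x≤0)) xx<0

  *-cancel-nonNeg : ∀ {x y} → 0# < x → 0# ≤ x * y → 0# ≤ y
  *-cancel-nonNeg {x} {y} 0<x 0≤xy y<0 = 0≤xy (0<y-x⇒x<y (<-respʳ
    (solve 2 (λ x y → x :* (:0 :- y) := :0 :- x :* y) refl x y)
    (*-pos 0<x (x<y⇒0<y-x y<0))))

  -- A strict conclusion admits no argument by contradiction, so the inverse `e` of `x` is supplied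
  -- and multiplied in.
  *-cancel-pos : ∀ {e x y} → 0# < e → e * x ≈ 1# → 0# < x * y → 0# < y
  *-cancel-pos {e} {x} {y} 0<e ex≈1 0<xy = <-respʳ
    (trans (sym (*-assoc e x y)) (trans (*-congʳ ex≈1) (*-identityˡ y))) (*-pos 0<e 0<xy)

  -- Lets an equation `l ≈ r` take part in a solver identity: the identity carries an extra summand
  -- `e * (l - r)`, which is removed afterwards.
  *-cong-diff : ∀ e {l r} → l ≈ r → e * (l - r) ≈ 0#
  *-cong-diff e {r = r} l≈r = trans (*-congˡ (trans (+-congʳ l≈r) (-‿inverseʳ r))) (zeroʳ e)

  ι-mono-≤ : ∀ {p q} → p ℚ.≤ q → ι p ≤ ι q
  ι-mono-≤ {p} {q} p≤q with ℚ.<-cmp p q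
  ... | tri< p<q _ _    = <⇒≤ (ι-mono-< p<q)
  ... | tri≈ _ ≡.refl _ = <-irrefl refl
  ... | tri> _ _ q<p    = contradiction (ℚ.<-≤-trans q<p p≤q) (ℚ.<-irrefl ≡.refl)

  nat-nonNeg : ∀ n → 0# ≤ nat n
  nat-nonNeg n = 0≤-resp (sym (nat-ι n)) (≤-trans (≈⇒≤ (sym ι.0#-homo)) (ι-mono-≤ (/-nonNeg n 1)))

  0<1 : 0# < 1#
  0<1 = <-respˡ ι.0#-homo (<-respʳ ι.1#-homo (ι-mono-< (ℚ.positive⁻¹ 1ℚ)))

  nat-pos : ∀ n .{{_ : NonZero n}} → 0# < nat n
  nat-pos (suc n) = <-respʳ (sym (nat-suc n)) (+-pos-nonNeg 0<1 (nat-nonNeg n))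

  nat-mono : ∀ {m n} → m ℕ.≤ n → nat m ≤ nat n
  nat-mono {n = n} ℕ.z≤n = nat-nonNeg n
  nat-mono {suc m} {suc n} (ℕ.s≤s m≤n) = 0≤y-x⇒x≤y (0≤-resp
    (trans (solve 2 (λ m n → n :- m := (:1 :+ n) :- (:1 :+ m)) refl (nat m) (nat n))
      (+-cong (sym (nat-suc n)) (-‿cong (sym (nat-suc m))))) (x≤y⇒0≤y-x (nat-mono m≤n)))

  ι-/ : ∀ m d .{{_ : NonZero d}} → ι (+ m / d) * nat d ≈ nat m
  ι-/ m d = trans (*-congˡ (nat-ι d)) (trans (sym (ι.*-homo (+ m / d) (+ d / 1)))
    (trans (reflexive (≡.cong ι (/-*-cancel (+ m) d))) (sym (nat-ι m))))

  inv : ∀ n .{{_ : NonZero n}} → Carrier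
  inv n = ι (+ 1 / n)

  inv-pos : ∀ n .{{_ : NonZero n}} → 0# < inv n
  inv-pos n = <-respˡ ι.0#-homo (ι-mono-< (ℚ.positive⁻¹ (+ 1 / n) {{ℚ.normalize-pos 1 n}}))

  inv-nat : ∀ n .{{_ : NonZero n}} → inv n * nat n ≈ 1#
  inv-nat n = ι-/ 1 n

  ι-1- : ∀ q → ι (1ℚ ℚ.- q) ≈ 1# - ι q
  ι-1- q = trans (ι.+-homo 1ℚ (ℚ.- q)) (+-cong ι.1#-homo (ι.-‿homo q))

  nat-* : ∀ m n → nat (m ℕ.* n) ≈ nat m * nat n
  nat-* m n = trans (nat-ι (m ℕ.* n)) (trans (reflexive (≡.cong ι (≡.trans
    (≡.cong (_/ 1) (ℤ.pos-* m n)) (*-/1 (+ m) (+ n)))))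
    (trans (ι.*-homo _ _) (*-cong (sym (nat-ι m)) (sym (nat-ι n)))))

-- Finite sums, Kronecker delta and indicator functions.

module FiniteSums {ℓ ℓ₁ ℓ₂} (R : Reals ℓ ℓ₁ ℓ₂) where
  open Reals R hiding (zero)
  open RealArithmetic R
  private
    module S = SemiringSum (CommutativeRing.semiring ring)

  -- Opaque, so that the length of an unfolded sum need not be inferred.
  opaque
    sum : ∀ {n} → (Fin n → Carrier) → Carrier
    sum = S.sum

    sum≡ : ∀ {n} (f : Fin n → Carrier) → sum f ≡ S.sum f
    sum≡ f = ≡.refl

    sum-[] : (f : Fin 0 → Carrier) → sum f ≈ 0#
    sum-[] f = refl

    sum-∷ : ∀ {n} (f : Fin (suc n) → Carrier) → sum f ≈ f zero + sum (f ∘ suc)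
    sum-∷ f = refl

    sum-cong : ∀ {n} {f g : Fin n → Carrier} → (∀ i → f i ≈ g i) → sum f ≈ sum g
    sum-cong = S.sum-cong-≋

    sum-+ : ∀ {n} (f g : Fin n → Carrier) → sum (λ i → f i + g i) ≈ sum f + sum g
    sum-+ = S.∑-distrib-+

    sum-comm : ∀ {m n} (f : Fin m → Fin n → Carrier) →
               sum (λ i → sum (f i)) ≈ sum (λ j → sum λ i → f i j)
    sum-comm = S.∑-comm

    sum-*ˡ : ∀ {n} d (f : Fin n → Carrier) → d * sum f ≈ sum (λ i → d * f i)
    sum-*ˡ = S.*-distribˡ-sum

    sum-*ʳ : ∀ {n} d (f : Fin n → Carrier) → sum f * d ≈ sum (λ i → f i * d)
    sum-*ʳ = S.*-distribʳ-sum

  sum-+* : ∀ {n} d (f g : Fin n → Carrier) → sum (λ i → f i + d * g i) ≈ sum f + d * sum g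
  sum-+* d f g = trans (sum-+ f (λ i → d * g i)) (+-congˡ (sym (sum-*ˡ d g)))

  sum-zero : ∀ {n} {f : Fin n → Carrier} → (∀ i → f i ≈ 0#) → sum f ≈ 0#
  sum-zero {f = f} f≈0 = trans (sum-cong λ i → trans (f≈0 i) (sym (zeroˡ (f i))))
    (trans (sym (sum-*ˡ 0# f)) (zeroˡ (sum f)))

  sum-nonNeg : ∀ {n} {f : Fin n → Carrier} → (∀ i → 0# ≤ f i) → 0# ≤ sum f
  sum-nonNeg {zero}  {f} 0≤f = ≈⇒≤ (sym (sum-[] f))
  sum-nonNeg {suc n} {f} 0≤f = 0≤-resp (sym (sum-∷ f)) (+-nonNeg (0≤f zero) (sum-nonNeg (0≤f ∘ suc)))

  term≤sum : ∀ {n} {f : Fin n → Carrier} → (∀ i → 0# ≤ f i) → ∀ i → f i ≤ sum f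
  term≤sum {suc n} {f} 0≤f zero    = ≤-by _ (sum-nonNeg (0≤f ∘ suc)) (trans (+-congʳ (sum-∷ f))
    (solve 2 (λ x y → x :+ y :- x := y) refl (f zero) (sum (f ∘ suc))))
  term≤sum {suc n} {f} 0≤f (suc i) = ≤-trans (term≤sum (0≤f ∘ suc) i) (≤-by _ (0≤f zero)
    (trans (+-congʳ (sum-∷ f)) (solve 2 (λ x y → x :+ y :- y := x) refl (f zero) (sum (f ∘ suc)))))

  δ : ∀ {n} → Fin n → Fin n → Carrier
  δ i j = if does (i ≟ j) then 1# else 0#

  sum-δ : ∀ {n} (i : Fin n) (f : Fin n → Carrier) → sum (λ j → δ i j * f j) ≈ f i
  sum-δ zero    f = trans (sum-∷ _) (trans
    (+-cong (*-identityˡ (f zero)) (sum-zero λ j → zeroˡ (f (suc j)))) (+-identityʳ _))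
  sum-δ (suc i) f = trans (sum-∷ _) (trans (+-cong (zeroˡ (f zero)) (sum-δ i (f ∘ suc))) (+-identityˡ _))

  δ-refl : ∀ {n} (i : Fin n) → δ i i ≡ 1#
  δ-refl i = ≡.cong (if_then 1# else 0#) (dec-true (i ≟ i) ≡.refl)

  δ-≢ : ∀ {n} {i j : Fin n} → i ≢ j → δ i j ≡ 0#
  δ-≢ {i = i} {j} i≢j = ≡.cong (if_then 1# else 0#) (dec-false (i ≟ j) i≢j)

  δ-nonNeg : ∀ {n} (i j : Fin n) → 0# ≤ δ i j
  δ-nonNeg i j with i ≟ j
  ... | yes _ = <⇒≤ 0<1
  ... | no  _ = <-irrefl refl

  total-δ : ∀ {n} (i : Fin n) → sum (δ i) ≈ 1#
  total-δ i = trans (sum-cong λ j → sym (*-identityʳ (δ i j))) (sum-δ i λ _ → 1#)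

  χ : ∀ {n} → Subset n → Fin n → Carrier
  χ S i = if does (i ∈? S) then 1# else 0#

  χ-∉ : ∀ {n} {S : Subset n} {i} → ¬ i ∈ S → χ S i ≡ 0#
  χ-∉ {S = S} {i} i∉S = ≡.cong (if_then 1# else 0#) (dec-false (i ∈? S) i∉S)

  total-χ : ∀ {n} (S : Subset n) → sum (χ S) ≈ nat ∣ S ∣
  total-χ []          = sum-[] _
  total-χ (true  ∷ S) = trans (sum-∷ _) (trans (+-congˡ (total-χ S)) (sym (nat-suc ∣ S ∣)))
  total-χ (false ∷ S) = trans (sum-∷ _) (trans (+-identityˡ _) (total-χ S))

-- The payoffs on V × V as a symmetric bilinear form.

module PayoffForm {ℓ ℓ₁ ℓ₂} (R : Reals ℓ ℓ₁ ℓ₂) {n} (G : Graph n) (τ ρ : ℚ) where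
  open Reals R hiding (zero)
  open RealArithmetic R
  open FiniteSums R
  open Graph G using (Adj; adj?; irrefl) renaming (sym to Adj-sym)

  A : Fin n → Fin n → Carrier
  A i j = ι (if does (adj? i j) then ρ else τ)

  A-adj : ∀ {i j} → Adj i j → A i j ≡ ι ρ
  A-adj {i} {j} p = ≡.cong (ι ∘ (if_then ρ else τ)) (dec-true (adj? i j) p)

  A-nonadj : ∀ {i j} → ¬ Adj i j → A i j ≡ ι τ
  A-nonadj {i} {j} ¬p = ≡.cong (ι ∘ (if_then ρ else τ)) (dec-false (adj? i j) ¬p)

  A-sym : ∀ i j → A i j ≡ A j i
  A-sym i j with adj? j i
  ... | yes p = A-adj (Adj-sym p)
  ... | no ¬p = A-nonadj (¬p ∘ Adj-sym)

  row : Fin n → (Fin n → Carrier) → Carrier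
  row i y = sum λ j → y j * A i j

  Q : (x y : Fin n → Carrier) → Carrier
  Q x y = sum λ i → x i * row i y

  row-+* : ∀ i x d v → row i (λ j → x j + d * v j) ≈ row i x + d * row i v
  row-+* i x d v = trans
    (sum-cong λ j → solve 4 (λ x d v w → (x :+ d :* v) :* w := x :* w :+ d :* (v :* w)) refl (x j) d (v j) (A i j))
    (sum-+* d _ _)

  Q-+*ˡ : ∀ x d v y → Q (λ i → x i + d * v i) y ≈ Q x y + d * Q v y
  Q-+*ˡ x d v y = trans
    (sum-cong λ i → solve 4 (λ x d v w → (x :+ d :* v) :* w := x :* w :+ d :* (v :* w)) refl (x i) d (v i) (row i y))
    (sum-+* d _ _)

  Q-sym : ∀ x y → Q x y ≈ Q y x
  Q-sym x y = trans (sum-cong λ i → sum-*ˡ (x i) _)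
    (trans (sum-comm λ i j → x i * (y j * A i j))
    (trans (sum-cong λ j → sum-cong λ i → trans
      (solve 3 (λ x y w → x :* (y :* w) := y :* (x :* w)) refl (x i) (y j) (A i j))
      (*-congˡ (*-congˡ (reflexive (A-sym i j)))))
    (sum-cong λ j → sym (sum-*ˡ (y j) _))))

  Q-+*ʳ : ∀ y x d v → Q y (λ i → x i + d * v i) ≈ Q y x + d * Q y v
  Q-+*ʳ y x d v = trans (Q-sym y _) (trans (Q-+*ˡ x d v y) (+-cong (Q-sym x y) (*-congˡ (Q-sym v y))))

  Q-+* : ∀ x d v → Q (λ i → x i + d * v i) (λ i → x i + d * v i) ≈ Q x x + (1# + 1#) * d * Q v x + d * d * Q v v
  Q-+* x d v = trans (Q-+*ˡ x d v y) (trans (+-cong (Q-+*ʳ x x d v) (*-congˡ (Q-+*ʳ v x d v)))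
    (trans (+-congʳ (+-congˡ (*-congˡ (Q-sym x v))))
    (solve 4 (λ q d p s → q :+ d :* p :+ d :* (p :+ d :* s) := q :+ (:1 :+ :1) :* d :* p :+ d :* d :* s) refl
      (Q x x) d (Q v x) (Q v v))))
    where y = λ i → x i + d * v i

  -- The direction that carries one unit of weight from `j` to `i`, written as `x + d * v` so that
  -- the linearity lemmas apply to it directly.
  move : (i j : Fin n) → Fin n → Carrier
  move i j l = δ i l + - 1# * δ j l

  sum-move : ∀ i j → sum (move i j) ≈ 0#
  sum-move i j = trans (sum-+* (- 1#) (δ i) (δ j))
    (trans (+-cong (total-δ i) (*-congˡ (total-δ j))) (solve 0 (:1 :+ (:- :1) :* :1 := :0) refl))

  Q-move : ∀ i j x → Q (move i j) x ≈ row i x - row j x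
  Q-move i j x = trans (Q-+*ˡ (δ i) (- 1#) (δ j) x) (trans
    (+-cong (sum-δ i λ l → row l x) (*-congˡ (sum-δ j λ l → row l x)))
    (solve 2 (λ p q → p :+ (:- :1) :* q := p :- q) refl (row i x) (row j x)))

  row-move : ∀ l i j → row l (move i j) ≈ A l i - A l j
  row-move l i j = trans (row-+* l (δ i) (- 1#) (δ j)) (trans
    (+-cong (sum-δ i (A l)) (*-congˡ (sum-δ j (A l))))
    (solve 2 (λ p q → p :+ (:- :1) :* q := p :- q) refl (A l i) (A l j)))

  -- All four entries of `A` on {i, j} equal τ, the diagonal ones included, and they cancel. Hence
  -- `Q` is affine along `move i j`.
  Q-move-move : ∀ {i j} → ¬ Adj i j → Q (move i j) (move i j) ≈ 0#
  Q-move-move {i} {j} ¬ij = trans (Q-move i j (move i j)) (trans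
    (+-cong (trans (row-move i i j) (+-cong (reflexive (A-nonadj (irrefl ≡.refl))) (-‿cong (reflexive (A-nonadj ¬ij)))))
      (-‿cong (trans (row-move j i j)
        (+-cong (reflexive (A-nonadj (¬ij ∘ Adj-sym))) (-‿cong (reflexive (A-nonadj (irrefl ≡.refl))))))))
    (solve 1 (λ t → (t :- t) :- (t :- t) := :0) refl (ι τ)))

  VanishesOff : Subset n → (Fin n → Carrier) → Set ℓ₁
  VanishesOff S x = ∀ i → ¬ i ∈ S → x i ≈ 0#

  -- On a clique `A` agrees with ρJ - (ρ-τ)I, where J is the all-ones matrix; columns outside `S`
  -- carry no weight.
  Q-clique : ∀ {S x} → IsClique G S → VanishesOff S x →
             Q x x ≈ ι ρ * (sum x * sum x) - (ι ρ - ι τ) * sum (λ i → x i * x i)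
  Q-clique {S} {x} clq off = trans (sum-cong term) (trans (sum-+* (- (ι ρ - ι τ)) _ _)
    (+-cong (sym (trans (*-congˡ (sum-*ʳ (sum x) x)) (sum-*ˡ (ι ρ) _)))
      (solve 2 (λ p q → (:- p) :* q := :- (p :* q)) refl (ι ρ - ι τ) (sum λ i → x i * x i))))
    where
    entry : ∀ {i} → i ∈ S → ∀ j → x j * A i j ≈ ι ρ * x j + - (ι ρ - ι τ) * (δ i j * x j)
    entry {i} i∈S j with i ≟ j | j ∈? S
    ... | yes ≡.refl | _       = trans (*-congˡ (reflexive (A-nonadj (irrefl ≡.refl))))
      (solve 3 (λ x r t → x :* t := r :* x :+ :- (r :- t) :* (:1 :* x)) refl (x j) (ι ρ) (ι τ))
    ... | no i≢j     | yes j∈S = trans (*-congˡ (reflexive (A-adj (clq i∈S j∈S i≢j))))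
      (solve 3 (λ x r t → x :* r := r :* x :+ :- (r :- t) :* (:0 :* x)) refl (x j) (ι ρ) (ι τ))
    ... | no _       | no j∉S  = trans (trans (*-congʳ xj≈0) (zeroˡ _)) (sym (trans
      (+-cong (*-congˡ xj≈0) (*-congˡ (zeroˡ (x j))))
      (solve 2 (λ r d → r :* :0 :+ d :* :0 := :0) refl (ι ρ) (- (ι ρ - ι τ)))))
      where xj≈0 = off j j∉S

    term : ∀ i → x i * row i x ≈ ι ρ * (x i * sum x) + - (ι ρ - ι τ) * (x i * x i)
    term i with i ∈? S
    ... | yes i∈S = trans (*-congˡ (trans (sum-cong (entry i∈S)) (trans (sum-+* (- (ι ρ - ι τ)) _ _)
        (+-cong (sym (sum-*ˡ (ι ρ) x)) (*-congˡ (sum-δ i x))))))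
      (solve 4 (λ x r s d → x :* (r :* s :+ d :* x) := r :* (x :* s) :+ d :* (x :* x)) refl
        (x i) (ι ρ) (sum x) (- (ι ρ - ι τ)))
    ... | no i∉S  = trans (trans (*-congʳ xi≈0) (zeroˡ _)) (sym (trans
      (+-cong (*-congˡ (trans (*-congʳ xi≈0) (zeroˡ _))) (*-congˡ (trans (*-congʳ xi≈0) (zeroˡ _))))
      (solve 2 (λ r d → r :* :0 :+ d :* :0 := :0) refl (ι ρ) (- (ι ρ - ι τ)))))
      where xi≈0 = off i i∉S

  -- Sum the squares (m xᵢ - X)² over i in `S`. This gives m²q - 2mX² + |S|X², and adding (m -
  -- |S|)X² turns it into m(mq - X²). The factor `χ S` in `dev` makes the constant term count |S|
  -- instead of all vertices.
  cauchy-schwarz : ∀ m .{{_ : NonZero m}} {S x} → ∣ S ∣ ℕ.≤ m → VanishesOff S x →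
                   sum x * sum x ≤ nat m * sum (λ i → x i * x i)
  cauchy-schwarz m {S} {x} ∣S∣≤m off = 0≤y-x⇒x≤y (*-cancel-nonNeg (nat-pos m) (0≤-resp
    (trans (+-cong expand refl) (solve 4 (λ m s X q →
       (m :* m :* q :+ :- ((:1 :+ :1) :* m :* X) :* X :+ X :* X :* s) :+ (m :- s) :* (X :* X)
         := m :* (m :* q :- X :* X)) refl (nat m) (nat ∣ S ∣) X q))
    (+-nonNeg (sum-nonNeg {f = dev} dev-nonNeg)
      (*-nonNeg (x≤y⇒0≤y-x (nat-mono ∣S∣≤m)) (sq-nonNeg X)))))
    where
    X q : Carrier
    X = sum x
    q = sum λ i → x i * x i

    dev : Fin n → Carrier
    dev i = (nat m * x i - X) * (nat m * x i - X) * χ S i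

    dev-nonNeg : ∀ i → 0# ≤ dev i
    dev-nonNeg i with i ∈? S
    ... | yes _ = 0≤-resp (sym (*-identityʳ _)) (sq-nonNeg (nat m * x i - X))
    ... | no  _ = ≈⇒≤ (sym (zeroʳ _))

    dev-expand : ∀ i → dev i ≈ (nat m * nat m * (x i * x i) + - ((1# + 1#) * nat m * X) * x i) + X * X * χ S i
    dev-expand i with i ∈? S
    ... | yes _  = solve 3 (λ m x X → (m :* x :- X) :* (m :* x :- X) :* :1 :=
      (m :* m :* (x :* x) :+ :- ((:1 :+ :1) :* m :* X) :* x) :+ X :* X :* :1) refl (nat m) (x i) X
    ... | no i∉S = trans (zeroʳ _) (sym (trans
      (+-congʳ (+-cong (*-congˡ (trans (*-congʳ (off i i∉S)) (zeroˡ _))) (*-congˡ (off i i∉S))))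
      (solve 3 (λ u v w → u :* :0 :+ v :* :0 :+ w :* :0 := :0) refl
        (nat m * nat m) (- ((1# + 1#) * nat m * X)) (X * X))))

    expand : sum dev ≈ nat m * nat m * q + - ((1# + 1#) * nat m * X) * X + X * X * nat ∣ S ∣
    expand = trans (sum-cong dev-expand) (trans (sum-+* (X * X) _ (χ S))
      (+-cong (trans (sum-+* (- ((1# + 1#) * nat m * X)) _ x) (+-congʳ (sym (sum-*ˡ (nat m * nat m) _))))
        (*-congˡ (total-χ S))))

  -- Merging the weights of two vertices.

  merge : (i j : Fin n) → (Fin n → Carrier) → Fin n → Carrier
  merge i j x l = x l + x j * move i j l

  sum-merge : ∀ i j x → sum (merge i j x) ≈ sum x
  sum-merge i j x = trans (sum-+* (x j) x (move i j))
    (trans (+-congˡ (trans (*-congˡ (sum-move i j)) (zeroʳ (x j)))) (+-identityʳ (sum x)))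

  module _ {i j : Fin n} (i≢j : i ≢ j) (x : Fin n → Carrier) where
    merge-source : merge i j x j ≈ 0#
    merge-source = trans
      (+-congˡ (*-congˡ (+-cong (reflexive (δ-≢ i≢j)) (*-congˡ (reflexive (δ-refl j))))))
      (solve 1 (λ x → x :+ x :* (:0 :+ (:- :1) :* :1) := :0) refl (x j))

    merge-other : ∀ {l} → j ≢ l → merge i j x l ≈ x l + x j * δ i l
    merge-other {l} j≢l = trans (+-congˡ (*-congˡ (+-congˡ (*-congˡ (reflexive (δ-≢ j≢l))))))
      (solve 3 (λ x y d → x :+ y :* (d :+ (:- :1) :* :0) := x :+ y :* d) refl (x l) (x j) (δ i l))

    merge-nonNeg : (∀ l → 0# ≤ x l) → ∀ l → 0# ≤ merge i j x l
    merge-nonNeg 0≤x l = case j ≟ l of λ where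
        (yes ≡.refl) → ≈⇒≤ (sym merge-source)
        (no j≢l)     → 0≤-resp (sym (merge-other j≢l)) (+-nonNeg (0≤x l) (*-nonNeg (0≤x j) (δ-nonNeg i l)))

    merge-vanishes : ∀ {S} → i ∈ S → VanishesOff S x → VanishesOff (S Subset.- j) (merge i j x)
    merge-vanishes {S} i∈S off l l∉S-j = case j ≟ l of λ where
      (yes ≡.refl) → merge-source
      (no j≢l)     → let l∉S = λ l∈S → l∉S-j (x∈p∧x≢y⇒x∈p-y l∈S (j≢l ∘ ≡.sym)) in
        trans (merge-other j≢l) (trans
          (+-cong (off l l∉S) (*-congˡ (reflexive (δ-≢ {i = i} {l} λ where ≡.refl → l∉S i∈S))))
          (trans (+-identityˡ _) (zeroʳ (x j))))

  -- With the quadratic term gone by `Q-move-move`, the gain is exactly 2 xⱼ (`row i x` -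
  -- `row j x`).
  Q-merge : ∀ {i j} x → ¬ Adj i j → 0# ≤ x j → row j x ≤ row i x → Q x x ≤ Q (merge i j x) (merge i j x)
  Q-merge {i} {j} x ¬ij 0≤xj rj≤ri = ≤-by ((1# + 1#) * x j * (row i x - row j x))
    (*-nonNeg (*-nonNeg (+-nonNeg (<⇒≤ 0<1) (<⇒≤ 0<1)) 0≤xj) (x≤y⇒0≤y-x rj≤ri))
    (trans (+-congʳ (trans (Q-+* x (x j) (move i j))
      (+-cong (+-congˡ (*-congˡ (Q-move i j x))) (*-congˡ (Q-move-move ¬ij)))))
      (solve 3 (λ q u v → q :+ u :+ v :* :0 :- q := u) refl
        (Q x x) ((1# + 1#) * x j * (row i x - row j x)) (x j * x j)))

  -- Motzkin–Straus: moving all the weight of a vertex to a non-adjacent one is a linear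
  -- perturbation of Q, so in one of the two directions Q does not decrease; this
  -- shrinks the support until it is a clique, where Cauchy–Schwarz applies.
  module _ (m : ℕ) .{{_ : NonZero m}} (τ≤ρ : ι τ ≤ ι ρ)
           (clique≤m : ∀ C → IsClique G C → ∣ C ∣ ℕ.≤ m) where

    -- This is m times the Motzkin-Straus value ρ - (ρ-τ)/m; the bounds are kept scaled by m to
    -- avoid division.
    M : Carrier
    M = nat m * ι ρ - (ι ρ - ι τ)

    -- By `Q-clique` the difference of the two sides is (ρ-τ)(mq - X²), which `cauchy-schwarz` makes
    -- nonnegative.
    clique-bound : ∀ {S x} → IsClique G S → VanishesOff S x → nat m * Q x x ≤ M * (sum x * sum x)
    clique-bound {S} {x} clq off = ≤-by ((ι ρ - ι τ) * (nat m * q - sum x * sum x))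
      (*-nonNeg (x≤y⇒0≤y-x τ≤ρ) (x≤y⇒0≤y-x (cauchy-schwarz m (clique≤m S clq) off)))
      (trans (+-congˡ (-‿cong (*-congˡ (Q-clique clq off))))
        (solve 5 (λ m r d X q → (m :* r :- d) :* X :- m :* (r :* X :- d :* q) := d :* (m :* q :- X)) refl
          (nat m) (ι ρ) (ι ρ - ι τ) (sum x * sum x) q))
      where q = sum λ i → x i * x i

    support-bound : ∀ S → Acc ℕ._<_ ∣ S ∣ → ∀ x → (∀ i → 0# ≤ x i) → VanishesOff S x →
                    nat m * Q x x ≤ M * (sum x * sum x)
    support-bound S (acc rec) x 0≤x off
      with any? (λ i → any? λ j → (i ∈? S) ×-dec (j ∈? S) ×-dec ¬? (i ≟ j) ×-dec ¬? (adj? i j))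
    ... | no none = clique-bound (λ {i} {j} i∈S j∈S i≢j →
      decidable-stable (adj? i j) λ ¬ij → none (i , j , i∈S , j∈S , i≢j , ¬ij)) off
    -- Which row is larger is undecidable, but the goal is a negation, so with `bad` at hand
    -- `≤-total` supplies both cases; the second is the first with `i` and `j` exchanged.
    ... | yes (i , j , i∈S , j∈S , i≢j , ¬ij) = λ bad → ≤-total (row i x) (row j x) λ where
        (inj₁ ri≤rj) → step j∈S i∈S (i≢j ∘ ≡.sym) (¬ij ∘ Adj-sym) ri≤rj bad
        (inj₂ rj≤ri) → step i∈S j∈S i≢j ¬ij rj≤ri bad
      where
      step : ∀ {i j} → i ∈ S → j ∈ S → i ≢ j → ¬ Adj i j → row j x ≤ row i x →
             nat m * Q x x ≤ M * (sum x * sum x)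
      step {i} {j} i∈S j∈S i≢j ¬ij rj≤ri = ≤-trans
        (≤-by _ (*-nonNeg (nat-nonNeg m) (x≤y⇒0≤y-x (Q-merge x ¬ij (0≤x j) rj≤ri)))
          (solve 3 (λ m p q → m :* p :- m :* q := m :* (p :- q)) refl (nat m) _ _))
        (≤-trans
          (support-bound (S Subset.- j) (rec (x∈p⇒∣p-x∣<∣p∣ j∈S)) (merge i j x)
            (merge-nonNeg i≢j x 0≤x) (merge-vanishes i≢j x i∈S off))
          (≈⇒≤ (*-congˡ (*-cong (sum-merge i j x) (sum-merge i j x)))))

    motzkin-straus : ∀ x → (∀ i → 0# ≤ x i) → nat m * Q x x ≤ M * (sum x * sum x)
    motzkin-straus x 0≤x = support-bound ⊤ (<-wellFounded _) x 0≤x λ i i∉⊤ → contradiction ∈⊤ i∉⊤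

-- What the two parameter ranges give.

module Ranges {ℓ ℓ₁ ℓ₂} (R : Reals ℓ ℓ₁ ℓ₂) (n′ : ℕ) (τ ρ : ℚ) where
  open Reals R hiding (zero)
  open RealArithmetic R

  private
    n = suc n′
    r = ι ρ
    t = ι τ
    v = nat n′

  ι-offset : ι ((1ℚ ℚ.- ρ) ℚ.* (+ n′ / 1)) ≈ (1# - r) * v
  ι-offset = trans (ι.*-homo (1ℚ ℚ.- ρ) (+ n′ / 1)) (*-cong (ι-1- ρ) (sym (nat-ι n′)))

  τ-lower : (1ℚ ℚ.- ρ) ℚ.* (+ n′ / 1) ℚ.≤ τ → (1# - r) * v ≤ t
  τ-lower le = ≤-trans (≈⇒≤ (sym ι-offset)) (ι-mono-≤ le)

  -- Completing the square in σ: modulo σ² = 1 - ρ, the right side minus the left is (m+1)(ρ -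
  -- (1-σ)² - τ) + (1 - σ(m+1))². The upper bound on τ makes the first summand positive.
  first-range : InFirstRange R n τ ρ → ∀ m → nat (suc m) * (nat m * r - (r - t)) < nat m * nat m
  first-range (_ , _ , _ , σ , (_ , σσ≈) , t<) m = <-by _
    (+-pos-nonNeg (*-pos (nat-pos (suc m)) (x<y⇒0<y-x t<)) (sq-nonNeg (1# - σ * nat (suc m))))
    (trans (+-congˡ (-‿cong (*-congʳ (nat-suc m)))) (trans
      (solve 4 (λ m r t σ →
        m :* m :- (:1 :+ m) :* (m :* r :- (r :- t)) :=
        (:1 :+ m) :* (r :- (:1 :- σ) :* (:1 :- σ) :- t) :+ (:1 :- σ :* (:1 :+ m)) :* (:1 :- σ :* (:1 :+ m))
        :+ (:- (m :* (:1 :+ m))) :* (σ :* σ :- (:1 :- r))) refl (nat m) r t σ)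
      (trans (+-congˡ (*-cong-diff (- (nat m * (1# + nat m))) (trans σσ≈ (ι-1- ρ))))
      (trans (+-identityʳ _)
      (+-cong (*-congʳ (sym (nat-suc m))) (*-cong ns ns))))))
    where
    ns : 1# - σ * (1# + nat m) ≈ 1# - σ * nat (suc m)
    ns = +-congˡ (-‿cong (*-congˡ (sym (nat-suc m))))

  -- With `N` = n+1, `g` = 1/N and `h` = 1/N², the right side minus the left, times N, is
  -- (m+1)N((1-ρ)(n-1) + g - τ) + (n-m)(N²(ρ-1+h) + (1-ρ)N(n-m)). The bound on τ makes the first
  -- summand positive; m ≤ n and the bounds on ρ make the second nonnegative.
  second-range : InSecondRange n τ ρ → ∀ m → m ℕ.≤ n → nat (suc m) * (nat m * r - (r - t)) < nat m * nat m
  second-range (ρ> , ρ<1 , _ , τ<) m m≤n = 0<y-x⇒x<y (*-cancel-pos (inv-pos (suc n)) (inv-nat (suc n))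
    (<-respʳ
      (sym (trans (*-cong N≈ (+-congˡ (-‿cong (*-congʳ (nat-suc m))))) (trans
        (solve 6 (λ m r t v g h →
          (:1 :+ (:1 :+ v)) :* (m :* m :- (:1 :+ m) :* (m :* r :- (r :- t))) :=
          (:1 :+ m) :* ((:1 :+ (:1 :+ v)) :* ((:1 :- r) :* v :+ g :- t))
          :+ (:1 :+ v :- m) :* ((:1 :+ (:1 :+ v)) :* (:1 :+ (:1 :+ v)) :* (r :- (:1 :- h))
               :+ (:1 :- r) :* (:1 :+ (:1 :+ v)) :* (:1 :+ v :- m))
          :+ (:- (:1 :+ m)) :* (g :* (:1 :+ (:1 :+ v)) :- :1)
          :+ (:- (:1 :+ v :- m)) :* (h :* ((:1 :+ (:1 :+ v)) :* (:1 :+ (:1 :+ v))) :- :1))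
          refl (nat m) r t v g h)
        (trans (+-cong (+-congˡ (*-cong-diff _ gN)) (*-cong-diff _ hNN))
        (trans (+-identityʳ _) (+-identityʳ _))))))
      (+-pos-nonNeg
        (*-pos (<-respʳ (nat-suc m) (nat-pos (suc m))) (*-pos N-pos (x<y⇒0<y-x t<)))
        (*-nonNeg n-m (+-nonNeg (*-nonNeg (sq-nonNeg N) (<⇒≤ (x<y⇒0<y-x r>)))
          (*-nonNeg (*-nonNeg (<⇒≤ (x<y⇒0<y-x r<1)) (<⇒≤ N-pos)) n-m))))))
    where
    N = 1# + (1# + v)
    g = inv (suc n)
    h = ι (+ 1 / (suc n ℕ.^ 2))

    N≈ : nat (suc n) ≈ N
    N≈ = +-congˡ (nat-suc n′)

    N-pos : 0# < N
    N-pos = <-respʳ N≈ (nat-pos (suc n))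

    gN : g * N ≈ 1#
    gN = trans (*-congˡ (sym N≈)) (inv-nat (suc n))

    hNN : h * (N * N) ≈ 1#
    hNN = trans (*-congˡ (trans (*-cong (sym N≈) (sym N≈)) (sym nat-sq))) (inv-nat (suc n ℕ.^ 2))
      where
      nat-sq : nat (suc n ℕ.^ 2) ≈ nat (suc n) * nat (suc n)
      nat-sq = trans (reflexive (≡.cong (λ z → nat (suc n ℕ.* z)) (ℕ.*-identityʳ (suc n)))) (nat-* (suc n) (suc n))

    r> : 1# - h < r
    r> = <-respˡ (ι-1- _) (ι-mono-< ρ>)

    r<1 : r < 1#
    r<1 = <-respʳ ι.1#-homo (ι-mono-< ρ<1)

    t< : t < (1# - r) * v + g
    t< = <-respʳ (trans (ι.+-homo _ _) (+-congʳ ι-offset)) (ι-mono-< τ<)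

    n-m : 0# ≤ 1# + v - nat m
    n-m = 0≤-resp (+-congʳ (nat-suc n′)) (x≤y⇒0≤y-x (nat-mono m≤n))

  -- If m bounds the clique number, this puts the Motzkin–Straus bound ρ - (ρ-τ)/m for
  -- xᵀAx below λ(m+1) = m/(m+1).
  key : InFirstRange R n τ ρ ⊎ InSecondRange n τ ρ → ∀ m → m ℕ.≤ n →
        nat (suc m) * (nat m * r - (r - t)) < nat m * nat m
  key (inj₁ r₁) m _ = first-range r₁ m
  key (inj₂ r₂)     = second-range r₂

-- Payoffs of mixed strategies in terms of the total weights on V, {a} and {b, c}.

module CliqueGame {ℓ ℓ₁ ℓ₂} (R : Reals ℓ ℓ₁ ℓ₂) {n} (k : ℕ) .{{_ : NonZero k}} (τ ρ : ℚ) (G : Graph n) where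
  open Reals R hiding (zero)
  open RealArithmetic R
  open FiniteSums R
  open PayoffForm R G τ ρ public

  Γ : SymmetricGame R
  Γ = cliqueGame R k τ ρ G

  open MixedStrategy public using (prob; nonNeg; total)

  private
    module S = SemiringSum (CommutativeRing.semiring ring)
    r = ι ρ
    t = ι τ
    l = ι (lam k)

    ∑-splitAt : ∀ m (f : Strategy m → Carrier) →
                S.sum (f ∘ splitAt m) ≈ S.sum (f ∘ inj₁) + (f a + (f b + f c))
    ∑-splitAt zero    f = trans (+-congˡ (+-congˡ (+-identityʳ (f c)))) (sym (+-identityˡ _))
    ∑-splitAt (suc m) f = trans (+-congˡ (∑-splitAt m (f ∘ Sum.map₁ suc))) (sym (+-assoc _ _ _))

  ∑-split : (f : Strategy n → Carrier) → ∑ R Γ f ≈ sum (f ∘ inj₁) + (f a + (f b + f c))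
  ∑-split f = trans (∑-splitAt n f) (+-congʳ (reflexive (≡.sym (sum≡ (f ∘ inj₁)))))

  Mixed : Set _
  Mixed = MixedStrategy R Γ

  U : Mixed → Mixed → Carrier
  U = U₁ R Γ

  xs : Mixed → Fin n → Carrier
  xs s i = prob s (vertex i)

  X pa py : Mixed → Carrier
  X  s = sum (xs s)
  pa s = prob s a
  py s = prob s b + prob s c

  X-nonNeg : ∀ s → 0# ≤ X s
  X-nonNeg s = sum-nonNeg (nonNeg s ∘ inj₁)

  py-nonNeg : ∀ s → 0# ≤ py s
  py-nonNeg s = +-nonNeg (nonNeg s b) (nonNeg s c)

  total-split : ∀ s → X s + (pa s + py s) ≈ 1#
  total-split s = trans (sym (∑-split (prob s))) (total s)

  mixed : (x : Fin n → Carrier) (p q₁ q₂ : Carrier) → (∀ i → 0# ≤ x i) → 0# ≤ p → 0# ≤ q₁ → 0# ≤ q₂ →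
          sum x + (p + (q₁ + q₂)) ≈ 1# → Mixed
  mixed x p q₁ q₂ 0≤x 0≤p 0≤q₁ 0≤q₂ tot = record
    { prob   = pr
    ; nonNeg = λ { (vertex i) → 0≤x i ; a → 0≤p ; b → 0≤q₁ ; c → 0≤q₂ }
    ; total  = trans (∑-split pr) tot
    }
    where
    pr : Strategy n → Carrier
    pr (vertex i) = x i
    pr a          = p
    pr b          = q₁
    pr c          = q₂

  -- The payoff of weights X, p, y on V, {a}, {b, c} against X′, p′, y′, where q is the
  -- part coming from V × V.
  value : (q X p y X′ p′ y′ : Carrier) → Carrier
  value q X p y X′ p′ y′ = q + X * (p′ * r) + p * (X′ * l + p′ * r) + y * (X′ * r + p′ * t) + y′ * t

  value-cong : ∀ {q₁ q₂ X₁ X₂ p₁ p₂ y₁ y₂ X₁′ X₂′ p₁′ p₂′ y₁′ y₂′} → q₁ ≈ q₂ → X₁ ≈ X₂ → p₁ ≈ p₂ → y₁ ≈ y₂ →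
               X₁′ ≈ X₂′ → p₁′ ≈ p₂′ → y₁′ ≈ y₂′ →
               value q₁ X₁ p₁ y₁ X₁′ p₁′ y₁′ ≈ value q₂ X₂ p₂ y₂ X₂′ p₂′ y₂′
  value-cong q X p y X′ p′ y′ = +-cong (+-cong (+-cong (+-cong q (*-cong X (*-congʳ p′)))
    (*-cong p (+-cong (*-congʳ X′) (*-congʳ p′)))) (*-cong y (+-cong (*-congʳ X′) (*-congʳ p′)))) (*-congʳ y′)

  -- Outside V × V the payoffs are constant on the blocks V, {a} and {b, c}. Columns `b` and `c` pay
  -- τ to every row, so they contribute `py s′ * t` times the total weight of `s`, which is 1.
  U-value : ∀ s s′ → U s s′ ≈ value (Q (xs s) (xs s′)) (X s) (pa s) (py s) (X s′) (pa s′) (py s′)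
  U-value s s′ = trans (∑-split λ i → ∑ R Γ λ j → prob s i * prob s′ j * u i j) (trans
    (+-cong (sum-cong λ i → trans (inner (vertex i) (xs s i)) (distribˡ (xs s i) _ _))
      (+-cong (const a l (λ _ → refl)) (+-cong (const b r (λ _ → refl)) (const c r (λ _ → refl)))))
    (trans (+-congʳ (trans (sum-+ _ _) (+-congˡ (sym (sum-*ʳ _ (xs s))))))
    (trans
      (solve 12 (λ q X p y₁ y₂ X′ p′ y₁′ y₂′ r t l →
        (q :+ X :* (p′ :* r :+ (y₁′ :* t :+ y₂′ :* t))) :+
        (p :* (X′ :* l :+ (p′ :* r :+ (y₁′ :* t :+ y₂′ :* t))) :+
        (y₁ :* (X′ :* r :+ (p′ :* t :+ (y₁′ :* t :+ y₂′ :* t))) :+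
         y₂ :* (X′ :* r :+ (p′ :* t :+ (y₁′ :* t :+ y₂′ :* t)))))
        := (q :+ X :* (p′ :* r) :+ p :* (X′ :* l :+ p′ :* r) :+ (y₁ :+ y₂) :* (X′ :* r :+ p′ :* t) :+ (y₁′ :+ y₂′) :* t)
           :+ ((y₁′ :+ y₂′) :* t) :* ((X :+ (p :+ (y₁ :+ y₂))) :- :1)) refl
        (Q (xs s) (xs s′)) (X s) (pa s) (prob s b) (prob s c) (X s′) (pa s′) (prob s′ b) (prob s′ c) r t l)
    (trans (+-congˡ (*-cong-diff (py s′ * t) (total-split s))) (+-identityʳ _)))))
    where
    u : Strategy n → Strategy n → Carrier
    u i j = ι (payoff k τ ρ G i j)

    inner : ∀ i w → ∑ R Γ (λ j → w * prob s′ j * u i j) ≈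
            w * (sum (λ j → xs s′ j * u i (vertex j)) + (pa s′ * u i a + (prob s′ b * u i b + prob s′ c * u i c)))
    inner i w = trans (∑-split λ j → w * prob s′ j * u i j) (trans
      (+-congʳ (trans (sum-cong λ j → *-assoc w _ _) (sym (sum-*ˡ w λ j → xs s′ j * u i (vertex j)))))
      (solve 8 (λ w q p ua y ub z uc → w :* q :+ (w :* p :* ua :+ (w :* y :* ub :+ w :* z :* uc)) :=
         w :* (q :+ (p :* ua :+ (y :* ub :+ z :* uc)))) refl
         w (sum λ j → xs s′ j * u i (vertex j)) (pa s′) (u i a) (prob s′ b) (u i b) (prob s′ c) (u i c)))

    const : ∀ i d → (∀ j → u i (vertex j) ≈ d) → ∑ R Γ (λ j → prob s i * prob s′ j * u i j) ≈
            prob s i * (X s′ * d + (pa s′ * u i a + (prob s′ b * u i b + prob s′ c * u i c)))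
    const i d eq = trans (inner i (prob s i)) (*-congˡ (+-congʳ
      (trans (sum-cong λ j → *-congˡ (eq j)) (sym (sum-*ʳ d (xs s′))))))

-- Cliques of prescribed size.

subset-of-size : ∀ {n} (C : Subset n) {k} → k ℕ.≤ ∣ C ∣ → ∃[ D ] D ⊆ C × ∣ D ∣ ≡ k
subset-of-size {n} C           {zero}  _ = Subset.⊥ , (λ i∈⊥ → contradiction i∈⊥ ∉⊥) , ∣⊥∣≡0 n
subset-of-size (true  ∷ C) {suc k} (ℕ.s≤s k≤) with D , D⊆C , ≡k ← subset-of-size C k≤ =
  true ∷ D , (λ { here → here ; (there i∈D) → there (D⊆C i∈D) }) , ≡.cong suc ≡k
subset-of-size (false ∷ C) {suc k} k≤ with D , D⊆C , ≡k ← subset-of-size C k≤ =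
  false ∷ D , (λ { (there i∈D) → there (D⊆C i∈D) }) , ≡k

module _ {n} (G : Graph n) where
  -- `HasCliqueOfSize` asks for an exact size, so an oversized clique is trimmed to a subset, which
  -- is again a clique.
  no-larger-clique : ∀ {k} → ¬ HasCliqueOfSize G (suc k) → ∀ C → IsClique G C → ∣ C ∣ ℕ.≤ k
  no-larger-clique ¬clq C clq = ℕ.≮⇒≥ λ k<∣C∣ →
    let D , D⊆C , ≡k = subset-of-size C k<∣C∣ in
    ¬clq (D , (λ i∈D j∈D → clq (D⊆C i∈D) (D⊆C j∈D)) , ≡k)

  singleton-clique : Fin n → HasCliqueOfSize G 1
  singleton-clique i = ⁅ i ⁆ ,
    (λ p q p≢q → contradiction (≡.trans (x∈⁅y⁆⇒x≡y i p) (≡.sym (x∈⁅y⁆⇒x≡y i q))) p≢q) ,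
    ∣⁅x⁆∣≡1 i

-- The pure strategy `a` and the payoffs for and against it.

module _ {ℓ ℓ₁ ℓ₂} (R : Reals ℓ ℓ₁ ℓ₂) {n} (k′ : ℕ) (G : Graph n) (τ ρ : ℚ) (τ<ρ : τ ℚ.< ρ) where
  open Reals R hiding (zero)
  open RealArithmetic R
  open FiniteSums R
  private
    k = suc k′
    r = ι ρ
    t = ι τ
    l = ι (lam k)
  open CliqueGame R k τ ρ G

  τ<ρ′ : t < r
  τ<ρ′ = ι-mono-< τ<ρ

  kλ : nat k * l ≈ nat k′
  kλ = trans (*-comm _ _) (ι-/ k′ k)

  origin : Fin n → Carrier
  origin _ = 0#

  sum-origin : sum origin ≈ 0#
  sum-origin = sum-zero λ _ → refl

  Q-zeroˡ : ∀ {x} y → (∀ i → x i ≈ 0#) → Q x y ≈ 0#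
  Q-zeroˡ y x≈0 = sum-zero λ i → trans (*-congʳ (x≈0 i)) (zeroˡ (row i y))

  Q-zeroʳ : ∀ x {y} → (∀ i → y i ≈ 0#) → Q x y ≈ 0#
  Q-zeroʳ x y≈0 = trans (Q-sym x _) (Q-zeroˡ x y≈0)

  pure-a : Mixed
  pure-a = mixed origin 1# 0# 0# (λ _ → <-irrefl refl) (<⇒≤ 0<1) (<-irrefl refl) (<-irrefl refl)
    (trans (+-congʳ sum-origin) (solve 0 (:0 :+ (:1 :+ (:0 :+ :0)) := :1) refl))

  -- Against `a`, weight on V and `a` earns ρ, while each unit on `b` or `c` loses ρ - τ. This makes
  -- `a` a best response to itself and keeps other best responses off `b` and `c`.
  U-against-a : ∀ s → U s pure-a ≈ r - py s * (r - t)
  U-against-a s = trans (U-value s pure-a) (trans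
    (value-cong (Q-zeroʳ (xs s) λ _ → refl) refl refl refl sum-origin refl (+-identityˡ 0#))
    (trans (solve 6 (λ X p y r t l →
      :0 :+ X :* (:1 :* r) :+ p :* (:0 :* l :+ :1 :* r) :+ y :* (:0 :* r :+ :1 :* t) :+ :0 :* t
      := r :- y :* (r :- t) :+ r :* (X :+ (p :+ y) :- :1)) refl (X s) (pa s) (py s) r t l)
    (trans (+-congˡ (*-cong-diff r (total-split s))) (+-identityʳ _))))

  U-a-a : U pure-a pure-a ≈ r
  U-a-a = trans (U-against-a pure-a)
    (solve 2 (λ r t → r :- (:0 :+ :0) :* (r :- t) := r) refl r t)

  U-of-a : ∀ s → U pure-a s ≈ X s * l + pa s * r + py s * t
  U-of-a s = trans (U-value pure-a s) (trans
    (value-cong (Q-zeroˡ (xs s) λ _ → refl) sum-origin refl (+-identityˡ 0#) refl refl refl)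
    (solve 6 (λ X p y r t l →
      :0 :+ :0 :* (p :* r) :+ :1 :* (X :* l :+ p :* r) :+ :0 :* (X :* r :+ p :* t) :+ y :* t
      := X :* l :+ p :* r :+ y :* t) refl (X s) (pa s) (py s) r t l))

  -- Without a clique of size k, `a` is evolutionarily stable.

  module NoClique (m : ℕ) .{{_ : NonZero m}} (m<k : suc m ℕ.≤ k)
      (clique≤m : ∀ C → IsClique G C → ∣ C ∣ ℕ.≤ m)
      (key : nat (suc m) * (nat m * r - (r - t)) < nat m * nat m) where

    -- λ is increasing and m + 1 ≤ k, so λ(k) ≥ λ(m+1) = m/(m+1).
    λ-bound : nat m ≤ nat (suc m) * l
    λ-bound = 0≤y-x⇒x≤y (*-cancel-nonNeg (nat-pos k) (0≤-resp
      (sym (trans (*-congˡ (+-congʳ (*-congʳ (nat-suc m)))) (trans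
        (solve 4 (λ K k′ m l → K :* ((:1 :+ m) :* l :- m) :=
          k′ :- m :+ (:1 :+ m) :* (K :* l :- k′) :+ (:- m) :* (K :- (:1 :+ k′)))
          refl (nat k) (nat k′) (nat m) l)
        (trans (+-cong (+-congˡ (*-cong-diff _ kλ)) (*-cong-diff _ (nat-suc k′)))
        (trans (+-identityʳ _) (+-identityʳ _))))))
      (x≤y⇒0≤y-x (nat-mono (ℕ.≤-pred m<k)))))

    -- Times m(m+1), the difference of the two sides splits into the slacks of `key`, `λ-bound` and
    -- `motzkin-straus`; only the first has to be strict. The inverses of m and m+1 then remove the
    -- factor.
    Q<λ : ∀ x → (∀ i → 0# ≤ x i) → 0# < sum x → Q x x < l * (sum x * sum x)
    Q<λ x 0≤x 0<X = 0<y-x⇒x<y (*-cancel-pos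
      (*-pos (inv-pos m) (inv-pos (suc m)))
      (trans (solve 4 (λ e f m n → e :* f :* (m :* n) := (e :* m) :* (f :* n)) refl
          (inv m) (inv (suc m)) (nat m) (nat (suc m)))
        (trans (*-cong (inv-nat m) (inv-nat (suc m))) (*-identityˡ 1#)))
      (<-respʳ
        (solve 6 (λ m n M l Z q →
          (m :* m :- n :* M) :* Z :+ (m :* (n :* l :- m) :* Z :+ n :* (M :* Z :- m :* q))
            := m :* n :* (l :* Z :- q)) refl
          (nat m) (nat (suc m)) (nat m * r - (r - t)) l (sum x * sum x) (Q x x))
        (+-pos-nonNeg (*-pos (x<y⇒0<y-x key) (*-pos 0<X 0<X))
          (+-nonNeg (*-nonNeg (*-nonNeg (nat-nonNeg m) (x≤y⇒0≤y-x λ-bound)) (sq-nonNeg (sum x)))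
            (*-nonNeg (nat-nonNeg (suc m)) (x≤y⇒0≤y-x (motzkin-straus m (<⇒≤ τ<ρ′) clique≤m x 0≤x)))))))

    py-vanishes : ∀ s → IsBestResponse R Γ s pure-a → py s ≈ 0#
    py-vanishes s br = ≤-antisym
      (≤-by (- py s) (*-cancel-nonNeg (x<y⇒0<y-x τ<ρ′) (0≤-resp
        (trans (+-cong (U-against-a s) (-‿cong U-a-a))
          (solve 3 (λ r t y → r :- y :* (r :- t) :- r := (r :- t) :* (:- y)) refl r t (py s)))
        (x≤y⇒0≤y-x (br pure-a)))) (+-identityˡ _))
      (py-nonNeg s)

    1-pa : ∀ s → 1# - pa s ≈ X s + py s
    1-pa s = trans
      (solve 3 (λ X p y → :1 :- p := X :+ y :+ (:- :1) :* (X :+ (p :+ y) :- :1)) refl (X s) (pa s) (py s))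
      (trans (+-congˡ (*-cong-diff (- 1#) (total-split s))) (+-identityʳ _))

    -- `Distinct` names a coordinate where the strategies are apart, which is the source of
    -- strictness: a vertex has positive weight, or 1 - `pa s`, equal to `X s` here, is positive.
    -- The coordinates `b` and `c` contradict `py s ≈ 0#`.
    X-pos : ∀ s → py s ≈ 0# → Distinct R Γ s pure-a → 0# < X s
    X-pos s y≈0 (vertex i , s#) with Equivalence.to #⇔<⊎> s#
    ... | inj₁ <0 = contradiction <0 (nonNeg s (vertex i))
    ... | inj₂ 0< = <-≤-trans 0< (term≤sum (nonNeg s ∘ inj₁) i)
    X-pos s y≈0 (a , s#) with Equivalence.to #⇔<⊎> s#
    ... | inj₁ <1 = <-respʳ (trans (1-pa s) (trans (+-congˡ y≈0) (+-identityʳ _))) (x<y⇒0<y-x <1)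
    ... | inj₂ 1< = contradiction 1< (≤-by _ (+-nonNeg (X-nonNeg s) (py-nonNeg s)) (1-pa s))
    X-pos s y≈0 (b , s#) with Equivalence.to #⇔<⊎> s#
    ... | inj₁ <0 = contradiction <0 (nonNeg s b)
    ... | inj₂ 0< = contradiction (<-respʳ y≈0 (+-pos-nonNeg 0< (nonNeg s c))) (<-irrefl refl)
    X-pos s y≈0 (c , s#) with Equivalence.to #⇔<⊎> s#
    ... | inj₁ <0 = contradiction <0 (nonNeg s c)
    ... | inj₂ 0< = contradiction (<-respʳ (trans (+-comm _ _) y≈0) (+-pos-nonNeg 0< (nonNeg s b))) (<-irrefl refl)

    a-is-ESS : IsESS R Γ pure-a
    a-is-ESS = (λ s → ≤-by _ (*-nonNeg (py-nonNeg s) (x≤y⇒0≤y-x (<⇒≤ τ<ρ′)))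
          (trans (+-cong U-a-a (-‿cong (U-against-a s)))
            (solve 3 (λ r t y → r :- (r :- y :* (r :- t)) := y :* (r :- t)) refl r t (py s))))
      , λ s br s#a → let y≈0 = py-vanishes s br in
        -- As X + p = 1, the difference U(a,s) - U(s,s) collapses to λX² - xᵀAx.
        <-by _ (x<y⇒0<y-x (Q<λ (xs s) (nonNeg s ∘ inj₁) (X-pos s y≈0 s#a))) (trans
          (+-cong (trans (U-of-a s) (+-congˡ (*-congʳ y≈0)))
            (-‿cong (trans (U-value s s) (value-cong refl refl refl y≈0 refl refl y≈0))))
          (trans
            (solve 6 (λ q X p r t l →
              X :* l :+ p :* r :+ :0 :* t :-
              (q :+ X :* (p :* r) :+ p :* (X :* l :+ p :* r) :+ :0 :* (X :* r :+ p :* t) :+ :0 :* t)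
              := l :* (X :* X) :- q :+ (:- (X :* l :+ p :* r)) :* (X :+ (p :+ :0) :- :1)) refl
              (Q (xs s) (xs s)) (X s) (pa s) r t l)
            (trans (+-congˡ (*-cong-diff _ (trans (+-congˡ (+-congˡ (sym y≈0))) (total-split s)))) (+-identityʳ _))))

  -- With a clique of size k, no `s` is evolutionarily stable.

  module HasClique .{{_ : NonZero n}} (τ-lower : ∀ m → suc m ℕ.≤ n → (1# - r) * nat m ≤ t)
      {C} (clq : IsClique G C) (∣C∣≡k : ∣ C ∣ ≡ k) {s} (ess : IsESS R Γ s) where
    x = xs s
    p = pa s

    U-equal-¬ESS : ∀ s′ → IsBestResponse R Γ s′ s → Distinct R Γ s′ s → ¬ U s s′ ≤ U s′ s′
    U-equal-¬ESS s′ br d ≤ = ≤ (proj₂ ess s′ br d)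

    -- `b` and `c` have the same payoffs as rows and as columns. Sharing their weight differently
    -- therefore changes no payoff and gives a best response that is not worse against itself.
    resplit-absurd : ∀ {q₁ q₂} → 0# ≤ q₁ → 0# ≤ q₂ → q₁ + q₂ ≈ py s → ¬ (prob s b # q₁)
    resplit-absurd {q₁} {q₂} 0≤q₁ 0≤q₂ q≈ sb# = U-equal-¬ESS s′
      (λ s″ → ≤-trans (proj₁ ess s″) (≈⇒≤ (sym (payoff-≈ s))))
      (b , #-sym sb#) (≈⇒≤ (sym (payoff-≈ s′)))
      where
      s′ = mixed x p q₁ q₂ (nonNeg s ∘ inj₁) (nonNeg s a) 0≤q₁ 0≤q₂
        (trans (+-congˡ (+-congˡ q≈)) (total-split s))
      payoff-≈ : ∀ s″ → U s′ s″ ≈ U s s″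
      payoff-≈ s″ = trans (U-value s′ s″)
        (trans (value-cong refl refl refl q≈ refl refl refl) (sym (U-value s s″)))

    py≈0 : py s ≈ 0#
    -- Cotransitivity yields a strict inequality at `b` in either case: if `b` has positive weight,
    -- all of `py s` is put on `c`; if it has less than `py s`, all is put on `b`.
    py≈0 = ≤-antisym (λ 0<py → case <-cotrans 0<py (prob s b) of λ where
        (inj₁ 0<sb) → resplit-absurd (<-irrefl refl) (py-nonNeg s) (+-identityˡ _)
          (Equivalence.from #⇔<⊎> (inj₂ 0<sb))
        (inj₂ sb<py) → resplit-absurd (py-nonNeg s) (<-irrefl refl) (+-identityʳ _)
          (Equivalence.from #⇔<⊎> (inj₁ sb<py)))
      (py-nonNeg s)

    X+p≈1 : X s + p ≈ 1#
    X+p≈1 = trans (+-congˡ (trans (sym (+-identityʳ p)) (+-congˡ (sym py≈0)))) (total-split s)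

    U-s-s : U s s ≈ value (Q x x) (X s) p 0# (X s) p 0#
    U-s-s = trans (U-value s s) (value-cong refl refl refl py≈0 refl refl py≈0)

    pure-b : Mixed
    pure-b = mixed origin 0# 1# 0# (λ _ → <-irrefl refl) (<-irrefl refl) (<⇒≤ 0<1) (<-irrefl refl)
      (trans (+-congʳ sum-origin) (solve 0 (:0 :+ (:0 :+ (:1 :+ :0)) := :1) refl))

    -- If p = 0, then `b` earns ρ against `s`, so ρ ≤ xᵀAx. But `motzkin-straus` with the trivial
    -- clique bound n gives xᵀAx ≤ ρ - (ρ-τ)/n.
    p>0 : ¬ ¬ (0# < p)
    p>0 p≤0 = ≤-trans n-r≤nQ (motzkin-straus n (<⇒≤ τ<ρ′) (λ C _ → ∣p∣≤n C) x (nonNeg s ∘ inj₁))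
      (0<y-x⇒x<y (<-respʳ
        (trans (solve 3 (λ n r t → r :- t := n :* r :- (n :* r :- (r :- t)) :* (:1 :* :1)) refl (nat n) r t)
          (+-congˡ (-‿cong (*-congˡ (*-cong (sym X≈1) (sym X≈1))))))
        (x<y⇒0<y-x τ<ρ′)))
      where
      p≈0 : p ≈ 0#
      p≈0 = ≤-antisym p≤0 (nonNeg s a)
      X≈1 : X s ≈ 1#
      X≈1 = trans (sym (+-identityʳ _)) (trans (+-congˡ (sym p≈0)) X+p≈1)
      r≤Q : r ≤ Q x x
      r≤Q = ≤-trans (≈⇒≤ (sym (trans (U-value pure-b s) (trans
          (value-cong (Q-zeroˡ x λ _ → refl) sum-origin refl (+-identityʳ 1#) X≈1 p≈0 py≈0)
          (solve 3 (λ r t l → :0 :+ :0 :* (:0 :* r) :+ :0 :* (:1 :* l :+ :0 :* r)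
              :+ :1 :* (:1 :* r :+ :0 :* t) :+ :0 :* t := r) refl r t l)))))
        (≤-trans (proj₁ ess pure-b) (≈⇒≤ (trans U-s-s (trans
          (value-cong refl X≈1 p≈0 refl X≈1 p≈0 refl)
          (solve 4 (λ q r t l → q :+ :1 :* (:0 :* r) :+ :0 :* (:1 :* l :+ :0 :* r)
              :+ :0 :* (:1 :* r :+ :0 :* t) :+ :0 :* t := q) refl (Q x x) r t l)))))
      n-r≤nQ : nat n * r ≤ nat n * Q x x
      n-r≤nQ = ≤-by _ (*-nonNeg (nat-nonNeg n) (x≤y⇒0≤y-x r≤Q))
        (solve 3 (λ n q r → n :* q :- n :* r := n :* (q :- r)) refl (nat n) (Q x x) r)

    -- s + p (s - a) is again a strategy; it would beat s if a did worse than s.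
    a-best-response : 0# < p → U s s ≤ U pure-a s
    a-best-response 0<p = 0≤y-x⇒x≤y (*-cancel-nonNeg 0<p (0≤-resp
      (trans (+-cong U-s-s (-‿cong (trans (U-value s′ s)
          (value-cong (Q-+*ˡ x p x x) sum-s′ refl (+-identityˡ 0#) refl refl py≈0))))
        (trans
          (solve 6 (λ q X p r t l →
            q :+ X :* (p :* r) :+ p :* (X :* l :+ p :* r) :+ :0 :* (X :* r :+ p :* t) :+ :0 :* t :-
            (q :+ p :* q :+ (X :+ p :* X) :* (p :* r) :+ (p :* p) :* (X :* l :+ p :* r)
              :+ :0 :* (X :* r :+ p :* t) :+ :0 :* t)
            := p :* (X :* l :+ p :* r :+ :0 :* t :-
            (q :+ X :* (p :* r) :+ p :* (X :* l :+ p :* r) :+ :0 :* (X :* r :+ p :* t) :+ :0 :* t))) refl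
            (Q x x) (X s) p r t l)
          (*-congˡ (+-cong (sym (trans (U-of-a s) (+-congˡ (*-congʳ py≈0)))) (-‿cong (sym U-s-s))))))
      (x≤y⇒0≤y-x (proj₁ ess s′))))
      where
      sum-s′ : sum (λ i → x i + p * x i) ≈ X s + p * X s
      sum-s′ = sum-+* p x x
      s′ = mixed (λ i → x i + p * x i) (p * p) 0# 0#
        (λ i → +-nonNeg (nonNeg s (inj₁ i)) (*-nonNeg (nonNeg s a) (nonNeg s (inj₁ i))))
        (sq-nonNeg p) (<-irrefl refl) (<-irrefl refl)
        (trans (+-congʳ sum-s′) (trans
          (solve 2 (λ X p → (X :+ p :* X) :+ (p :* p :+ (:0 :+ :0)) := :1 :+ (:1 :+ p) :* (X :+ p :- :1))
            refl (X s) p)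
          (trans (+-congˡ (*-cong-diff (1# + p) X+p≈1)) (+-identityʳ 1#))))

    U-s-a : U s pure-a ≈ r
    U-s-a = trans (U-against-a s) (trans (+-congˡ (-‿cong (*-congʳ py≈0)))
      (solve 2 (λ r t → r :- :0 :* (r :- t) := r) refl r t))

    p≈1 : p ≈ 1#
    p≈1 = proj₁ (tight p 1#) λ p#1 → p>0 λ 0<p → U-equal-¬ESS pure-a
      (λ s′ → ≤-trans (proj₁ ess s′) (a-best-response 0<p))
      (a , #-sym p#1)
      (≈⇒≤ (trans U-s-a (sym U-a-a)))

    X≈0 : X s ≈ 0#
    X≈0 = trans (solve 2 (λ X p → X := X :+ p :- p) refl (X s) p)
      (trans (+-cong X+p≈1 (-‿cong p≈1)) (-‿inverseʳ 1#))

    x≈0 : ∀ i → x i ≈ 0#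
    x≈0 i = ≤-antisym (≤-trans (term≤sum (nonNeg s ∘ inj₁) i) (≈⇒≤ X≈0)) (nonNeg s (inj₁ i))

    e : Carrier
    e = inv k

    -- The uniform distribution on the clique, which has the Motzkin-Straus value ρ - (ρ-τ)/k.
    y : Fin n → Carrier
    y i = χ C i * e

    sum-y : sum y ≈ 1#
    sum-y = trans (sym (sum-*ʳ e (χ C))) (trans (*-congʳ (trans (total-χ C) (reflexive (≡.cong nat ∣C∣≡k))))
      (trans (*-comm _ _) (inv-nat k)))

    y-nonNeg : ∀ i → 0# ≤ y i
    y-nonNeg i with i ∈? C
    ... | yes _ = *-nonNeg (<⇒≤ 0<1) (<⇒≤ (inv-pos k))
    ... | no  _ = ≈⇒≤ (sym (zeroˡ e))

    y-square : ∀ i → y i * y i ≈ e * y i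
    y-square i with i ∈? C
    ... | yes _ = solve 1 (λ e → (:1 :* e) :* (:1 :* e) := e :* (:1 :* e)) refl e
    ... | no  _ = solve 1 (λ e → (:0 :* e) :* (:0 :* e) := e :* (:0 :* e)) refl e

    uniform : Mixed
    uniform = mixed y 0# 0# 0# y-nonNeg (<-irrefl refl) (<-irrefl refl) (<-irrefl refl)
      (trans (+-congʳ sum-y) (solve 0 (:1 :+ (:0 :+ (:0 :+ :0)) := :1) refl))

    Q-y : Q y y ≈ r - (r - t) * e
    Q-y = trans (Q-clique clq (λ i i∉C → trans (*-congʳ (reflexive (χ-∉ i∉C))) (zeroˡ e)))
      (trans (+-cong (*-congˡ (*-cong sum-y sum-y)) (-‿cong (*-congˡ
        (trans (sum-cong y-square) (trans (sym (sum-*ˡ e y)) (*-congˡ sum-y))))))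
      (solve 3 (λ r d e → r :* (:1 :* :1) :- d :* (e :* :1) := r :- d :* e) refl r (r - t) e))

    -- k times the difference is τ - (1-ρ)(k-1), and k ≤ n because the clique consists of vertices,
    -- so `τ-lower` applies.
    λ≤Q-y : l ≤ Q y y
    λ≤Q-y = 0≤y-x⇒x≤y (*-cancel-nonNeg (nat-pos k) (0≤-resp
      (sym (trans (*-congˡ (+-congʳ Q-y)) (trans
        (solve 6 (λ K k′ e r t l → K :* (r :- (r :- t) :* e :- l) :=
          t :- (:1 :- r) :* k′ :+ (:- (r :- t)) :* (e :* K :- :1) :+ (:- :1) :* (K :* l :- k′) :+ r :* (K :- (:1 :+ k′)))
          refl (nat k) (nat k′) e r t l)
        (trans (+-cong (+-cong (+-congˡ (*-cong-diff _ (inv-nat k))) (*-cong-diff _ kλ)) (*-cong-diff _ (nat-suc k′)))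
        (trans (+-identityʳ _) (trans (+-identityʳ _) (+-identityʳ _)))))))
      (x≤y⇒0≤y-x (τ-lower k′ (≡.subst (ℕ._≤ n) ∣C∣≡k (∣p∣≤n C))))))

    -- By now `s` is `a`. The uniform strategy on the clique earns ρ against it, just as `a` does,
    -- so it is a best response; against the uniform strategy `a` earns λ(k), at most what that
    -- strategy earns against itself.
    not-ESS : Empty.⊥
    not-ESS = U-equal-¬ESS uniform
      (λ s′ → ≤-trans (proj₁ ess s′) (≈⇒≤ (trans U-s-s (trans
        (value-cong (Q-zeroˡ x x≈0) X≈0 p≈1 refl X≈0 p≈1 refl)
        (trans (solve 3 (λ r t l → :0 :+ :0 :* (:1 :* r) :+ :1 :* (:0 :* l :+ :1 :* r)
            :+ :0 :* (:0 :* r :+ :1 :* t) :+ :0 :* t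
          := :0 :+ :1 :* (:1 :* r) :+ :0 :* (:0 :* l :+ :1 :* r)
            :+ :0 :* (:0 :* r :+ :1 :* t) :+ :0 :* t) refl r t l)
        (sym (trans (U-value uniform s)
          (value-cong (Q-zeroʳ y x≈0) sum-y refl (+-identityˡ 0#) X≈0 p≈1 py≈0))))))))
      (a , Equivalence.from #⇔<⊎> (inj₁ (<-respʳ (sym p≈1) 0<1)))
      (≤-trans (≈⇒≤ (trans (U-value s uniform) (trans
          (value-cong (Q-zeroˡ y x≈0) X≈0 p≈1 py≈0 sum-y refl (+-identityˡ 0#))
          (solve 3 (λ r t l → :0 :+ :0 :* (:0 :* r) :+ :1 :* (:1 :* l :+ :0 :* r)
            :+ :0 :* (:1 :* r :+ :0 :* t) :+ :0 :* t := l) refl r t l))))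
      (≤-trans λ≤Q-y (≈⇒≤ (sym (trans (U-value uniform uniform) (trans
          (value-cong refl refl refl (+-identityˡ 0#) refl refl (+-identityˡ 0#))
          (solve 5 (λ q X r t l → q :+ X :* (:0 :* r) :+ :0 :* (X :* l :+ :0 :* r)
            :+ :0 :* (X :* r :+ :0 :* t) :+ :0 :* t := q) refl (Q y y) (sum y) r t l)))))))

theorem2 : ∀ {ℓ ℓ₁ ℓ₂} (R : Reals ℓ ℓ₁ ℓ₂)
    (n : ℕ) .{{_ : NonZero n}} (G : Graph n) (k : ℕ) .{{_ : NonZero k}}
    (τ ρ : ℚ) → 0ℚ ℚ.< τ → τ ℚ.< ρ → ρ ℚ.< 1ℚ →
    InFirstRange R n τ ρ ⊎ InSecondRange n τ ρ →
    HasESS R (cliqueGame R k τ ρ G) ⇔ (¬ HasCliqueOfSize G k)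
theorem2 R n@(suc n′) G k@(suc k′) τ ρ 0<τ τ<ρ ρ<1 range = mk⇔
  (λ (s , ess) (C , clq , ∣C∣≡k) → HasClique.not-ESS R k′ G τ ρ τ<ρ lower {C} clq ∣C∣≡k {s} ess)
  (noClique k′)
  where
  open Reals R using (_≤_; _*_; _-_; 1#; ι)
  open RealArithmetic R
  open Ranges R n′ τ ρ
  lower : ∀ m → suc m ℕ.≤ n → (1# - ι ρ) * nat m ≤ ι τ
  -- Both ranges give the bound for m = n - 1; it passes to smaller m because 1 - ρ is nonnegative.
  lower m (ℕ.s≤s m≤n′) = ≤-trans
    (≤-by _ (*-nonNeg (x≤y⇒0≤y-x (≤-trans (<⇒≤ (ι-mono-< ρ<1)) (≈⇒≤ ι.1#-homo))) (x≤y⇒0≤y-x (nat-mono m≤n′)))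
      (solve 3 (λ d v m → d :* v :- d :* m := d :* (v :- m)) refl (1# - ι ρ) (nat n′) (nat m)))
    (τ-lower ([ (λ r₁ → proj₁ (proj₂ (proj₂ r₁))) , (λ r₂ → proj₁ (proj₂ (proj₂ r₂))) ]′ range))
    where open Reals R using (refl; ι-mono-<)
  noClique : ∀ k′ → ¬ HasCliqueOfSize G (suc k′) → HasESS R (cliqueGame R (suc k′) τ ρ G)
  -- For k = 1 the hypothesis fails, since n ≥ 1 provides a vertex.
  noClique zero     ¬clq = contradiction (singleton-clique G zero) ¬clq
  noClique (suc k″) ¬clq = pure-a R (suc k″) G τ ρ τ<ρ , NoClique.a-is-ESS R (suc k″) G τ ρ τ<ρ m
    (ℕ.s≤s (ℕ.m⊓n≤m (suc k″) n))
    (λ C clq → ℕ.⊓-glb (no-larger-clique G ¬clq C clq) (∣p∣≤n C))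
    (key range m (ℕ.m⊓n≤n (suc k″) n))
    -- Bounding by k - 1 serves `λ-bound`, bounding by n serves `key`; both numbers are successors,
    -- so `m` is nonzero.
    where m = suc k″ ℕ.⊓ n
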